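{- There is an absolute constant $c$ such that for every integer $n\ge 2$ there exists an integer $d$ with $1\le d\le n-1$ and $\gcd(n,d)=1$ such that $s(n,d)\le c\,\frac{n}{\phi(n)}\log n\,\log\log n$.
   Context: $\phi$ is Euler's totient function; logarithms are natural. For positive integers $n,d$, the Euclidean algorithm sets $a_0=n$, $a_1=d$, and for $k\ge1$, as long as $a_k\neq 0$, defines $a_{k+1}$ as the remainder of $a_{k-1}$ upon division by $a_k$ and $q_k$ as the positive integer with $a_{k-1}=q_ka_k+a_{k+1}$; it stops at the first $\ell$ with $a_\ell=0$. The quotient sequence is $\mathbf{q}(n,d)=(q_1,\dots,q_{\ell-1})$, and $s(n,d)=q_1+\dots+q_{\ell-1}$ is the sum of the quotients.
   Formalization: The bound is stated for n ≥ 3 instead of n ≥ 2: at n = 2 one has log log 2 < 0 while s(2,1) = 2, which would force c < 0, whereas n = 3 forces c > 0, so the printed inequality cannot hold for n = 2 and n = 3 together. -}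

module Defs where

open import Data.Integer as ℤ using (+_)
import Data.Integer.Properties as ℤₚ
open import Data.List using (List; []; _∷_; filter; length; map; upTo)
open import Data.List.Membership.Propositional.Properties using (∈-filter⁺; ∈-length)
open import Data.List.Relation.Unary.Any using (here)
open import Data.Nat as ℕ using (ℕ; zero; suc; NonZero)
import Data.Nat.Properties as ℕₚ
import Data.Nat.DivMod as ℕD
open import Data.Nat.Coprimality using (coprime?; 1-coprimeTo)
open import Data.Nat.ListAction using (sum)
open import Data.Nat.Induction using (Acc; acc; <-wellFounded)
open import Data.Product using (∃-syntax; _×_; _,_)
open import Data.Rational as ℚ using (ℚ; 0ℚ; 1ℚ; ½; mkℚ; _/_; ∣_∣; 1/_; _+_; _-_; _*_; -_; _≤_; _<_)
open import Data.Rational.Properties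
import Data.Rational.Unnormalised as ℚᵘ
import Data.Rational.Unnormalised.Properties as ℚᵘₚ
open import Data.Rational.Solver using (module +-*-Solver)
open import Relation.Binary.PropositionalEquality using (_≡_; refl; sym; trans; cong; cong₂; subst)
open import Relation.Nullary using (yes; no; contradiction)

open +-*-Solver using (solve; con; _:=_; _:+_; _:*_; _:-_; :-_)

-- The recursion runs on the consecutive pairs (aₖ₋₁ , aₖ); its clause for
-- aₖ = 0 is the stopping condition of the Euclidean algorithm.
quotients-acc : (a b : ℕ) → Acc ℕ._<_ b → List ℕ
quotients-acc a zero    _        = []
quotients-acc a (suc b) (acc rs) =
  a ℕD./ suc b ∷ quotients-acc (suc b) (a ℕD.% suc b) (rs (ℕD.m%n<n a (suc b)))

quotients : ℕ → ℕ → List ℕ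
quotients n d = quotients-acc n d (<-wellFounded d)

s : ℕ → ℕ → ℕ
s n d = sum (quotients n d)

φ : ℕ → ℕ
φ n = length (filter (λ k → coprime? k n) (map suc (upTo n)))

φ-nonZero : ∀ {n} → 1 ℕ.≤ n → NonZero (φ n)
φ-nonZero {n@(suc _)} _ =
  ℕ.>-nonZero (∈-length (∈-filter⁺ (λ k → coprime? k n) (here refl) (1-coprimeTo n)))

+-nn : ∀ {p q} → 0ℚ ≤ p → 0ℚ ≤ q → 0ℚ ≤ p + q
+-nn p≥0 q≥0 = +-mono-≤ p≥0 q≥0

*-mono : ∀ {p q r t} → 0ℚ ≤ p → 0ℚ ≤ t → p ≤ q → r ≤ t → p * r ≤ q * t
*-mono {p} {q} {r} {t} p≥0 t≥0 p≤q r≤t = ≤-trans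
  (*-monoˡ-≤-nonNeg p {{ℚ.nonNegative p≥0}} r≤t)
  (*-monoʳ-≤-nonNeg t {{ℚ.nonNegative t≥0}} p≤q)

*-monoˡ : ∀ {p q r} → 0ℚ ≤ r → p ≤ q → r * p ≤ r * q
*-monoˡ {r = r} r≥0 = *-monoˡ-≤-nonNeg r {{ℚ.nonNegative r≥0}}

*-monoʳ : ∀ {p q r} → 0ℚ ≤ r → p ≤ q → p * r ≤ q * r
*-monoʳ {r = r} r≥0 = *-monoʳ-≤-nonNeg r {{ℚ.nonNegative r≥0}}

*-nn : ∀ {p q} → 0ℚ ≤ p → 0ℚ ≤ q → 0ℚ ≤ p * q
*-nn {p} {q} p≥0 q≥0 = subst (_≤ p * q) (*-zeroʳ p) (*-monoˡ p≥0 q≥0)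

*-pos : ∀ {p q} → 0ℚ < p → 0ℚ < q → 0ℚ < p * q
*-pos {p} {q} p>0 q>0 = subst (_< p * q) (*-zeroʳ p) (*-monoʳ-<-pos p {{ℚ.positive p>0}} q>0)

0<½ : 0ℚ < ½
0<½ = positive⁻¹ ½

0≤½ : 0ℚ ≤ ½
0≤½ = <⇒≤ 0<½

0<1 : 0ℚ < 1ℚ
0<1 = positive⁻¹ 1ℚ

⅓ : ℚ
⅓ = + 1 / 3

0<⅓ : 0ℚ < ⅓
0<⅓ = positive⁻¹ ⅓

tri : ∀ {x y z p q} → ∣ x - y ∣ ≤ p → ∣ y - z ∣ ≤ q → ∣ x - z ∣ ≤ p + q
tri {x} {y} {z} xy yz = subst (λ w → ∣ w ∣ ≤ _)
  (solve 3 (λ x y z → (x :- y) :+ (y :- z) := x :- z) refl x y z)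
  (≤-trans (∣p+q∣≤∣p∣+∣q∣ (x - y) (y - z)) (+-mono-≤ xy yz))

tri₂ : ∀ {x y x′ y′ p q} → ∣ x - x′ ∣ ≤ p → ∣ y - y′ ∣ ≤ q → ∣ (x + y) - (x′ + y′) ∣ ≤ p + q
tri₂ {x} {y} {x′} {y′} xx yy = subst (λ w → ∣ w ∣ ≤ _)
  (solve 4 (λ x y x′ y′ → (x :- x′) :+ (y :- y′) := (x :+ y) :- (x′ :+ y′)) refl x y x′ y′)
  (≤-trans (∣p+q∣≤∣p∣+∣q∣ (x - x′) (y - y′)) (+-mono-≤ xx yy))

∣∣-sym : ∀ x y → ∣ x - y ∣ ≡ ∣ y - x ∣
∣∣-sym x y = trans (sym (∣-p∣≡∣p∣ (x - y)))
  (cong ∣_∣ (solve 2 (λ x y → :- (x :- y) := y :- x) refl x y))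

-- Total reciprocal: early terms of a Cauchy sequence with positive limit
-- may vanish.
inv : ℚ → ℚ
inv p with p ≟ 0ℚ
... | yes _   = 0ℚ
... | no  p≢0 = (1/ p) {{ℚ.≢-nonZero p≢0}}

*-inv : ∀ {p} → 0ℚ < p → p * inv p ≡ 1ℚ
*-inv {p} p>0 with p ≟ 0ℚ
... | yes p≡0 = contradiction (sym p≡0) (<⇒≢ p>0)
... | no  p≢0 = *-inverseʳ p {{ℚ.≢-nonZero p≢0}}

inv>0 : ∀ {p} → 0ℚ < p → 0ℚ < inv p
inv>0 {p} p>0 = *-cancelˡ-<-nonNeg p {{ℚ.nonNegative (<⇒≤ p>0)}}
  (<-respʳ-≡ (sym (*-inv p>0)) (<-respˡ-≡ (sym (*-zeroʳ p)) 0<1))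

inv≥0 : ∀ {p} → 0ℚ < p → 0ℚ ≤ inv p
inv≥0 p>0 = <⇒≤ (inv>0 p>0)

inv-anti : ∀ {p q} → 0ℚ < p → p ≤ q → inv q ≤ inv p
inv-anti {p} {q} p>0 p≤q = subst₂′ lhs rhs
  (*-monoʳ (*-nn (inv≥0 p>0) (inv≥0 q>0)) p≤q)
  where
  q>0 : 0ℚ < q
  q>0 = <-≤-trans p>0 p≤q
  subst₂′ : ∀ {a b c d : ℚ} → a ≡ b → c ≡ d → a ≤ c → b ≤ d
  subst₂′ refl refl h = h
  lhs : p * (inv p * inv q) ≡ inv q
  lhs = trans (sym (*-assoc p (inv p) (inv q))) (trans (cong (_* inv q) (*-inv p>0)) (*-identityˡ _))
  rhs : q * (inv p * inv q) ≡ inv p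
  rhs = trans (solve 3 (λ q i j → q :* (i :* j) := i :* (q :* j)) refl q (inv p) (inv q))
              (trans (cong (inv p *_) (*-inv q>0)) (*-identityʳ _))

shrink : ∀ {K ε} → 0ℚ ≤ K → 0ℚ < ε → ∃[ δ ] 0ℚ < δ × K * δ ≤ ε
shrink {K} {ε} K≥0 ε>0 = ε * inv (K + 1ℚ) , *-pos ε>0 (inv>0 K+1>0) , ≤-trans
  (*-monoʳ (*-nn (<⇒≤ ε>0) (inv≥0 K+1>0)) K≤K+1)
  (≤-reflexive (trans
    (solve 3 (λ k e i → k :* (e :* i) := e :* (k :* i)) refl (K + 1ℚ) ε (inv (K + 1ℚ)))
    (trans (cong (ε *_) (*-inv K+1>0)) (*-identityʳ ε))))
  where
  K+1>0 : 0ℚ < K + 1ℚ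
  K+1>0 = +-mono-≤-< K≥0 0<1
  K≤K+1 : K ≤ K + 1ℚ
  K≤K+1 = subst (_≤ K + 1ℚ) (+-identityʳ K) (+-monoʳ-≤ K (<⇒≤ 0<1))

-- Real numbers as Cauchy sequences of rationals.  No quotient is taken:
-- the order relations below depend only on the represented reals.

Cauchy : (ℕ → ℚ) → Set
Cauchy x = ∀ ε → 0ℚ < ε → ∃[ N ] (∀ m n → N ℕ.≤ m → N ℕ.≤ n → ∣ x m - x n ∣ ≤ ε)

record ℝ : Set where
  constructor mkℝ
  field
    seq    : ℕ → ℚ
    cauchy : Cauchy seq

open ℝ public

infix 4 _≤ᵣ_ _<ᵣ_
infixl 7 _*ᵣ_

_≤ᵣ_ : ℝ → ℝ → Set
x ≤ᵣ y = ∀ ε → 0ℚ < ε → ∃[ N ] (∀ n → N ℕ.≤ n → seq x n ≤ seq y n + ε)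

_<ᵣ_ : ℝ → ℝ → Set
x <ᵣ y = ∃[ ε ] 0ℚ < ε × ∃[ N ] (∀ n → N ℕ.≤ n → seq x n + ε ≤ seq y n)

fromℚ : ℚ → ℝ
fromℚ q = mkℝ (λ _ → q) (λ ε ε>0 → 0 , λ _ _ _ _ →
  subst (λ w → ∣ w ∣ ≤ ε) (sym (+-inverseʳ q)) (<⇒≤ ε>0))

fromℕ : ℕ → ℝ
fromℕ n = fromℚ (+ n / 1)

0ᵣ : ℝ
0ᵣ = fromℚ 0ℚ

bounded : (x : ℝ) → ∃[ B ] 0ℚ ≤ B × ∃[ N ] (∀ n → N ℕ.≤ n → ∣ seq x n ∣ ≤ B)
bounded x with cauchy x 1ℚ 0<1
... | N , h = 1ℚ + ∣ seq x N ∣ , +-nn (<⇒≤ 0<1) (0≤∣p∣ (seq x N)) , N , λ n N≤n →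
  subst (λ w → ∣ w ∣ ≤ 1ℚ + ∣ seq x N ∣)
    (solve 2 (λ a b → (a :- b) :+ b := a) refl (seq x n) (seq x N))
    (≤-trans (∣p+q∣≤∣p∣+∣q∣ (seq x n - seq x N) (seq x N))
             (+-monoˡ-≤ ∣ seq x N ∣ (h n N N≤n ℕₚ.≤-refl)))

*-close : ∀ {a a′ c c′ B C δ η} → ∣ c ∣ ≤ C → ∣ a - a′ ∣ ≤ δ → 0ℚ ≤ δ →
          ∣ a′ ∣ ≤ B → ∣ c - c′ ∣ ≤ η → 0ℚ ≤ η → ∣ a * c - a′ * c′ ∣ ≤ C * δ + B * η
*-close {a} {a′} {c} {c′} {B} {C} {δ} {η} c≤ aa′ δ≥0 a′≤ cc′ η≥0 =
  tri {a * c} {a′ * c} {a′ * c′} {C * δ} {B * η}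
    (≤-trans (≤-reflexive (trans
        (cong ∣_∣ (solve 3 (λ a b c → a :* c :- b :* c := c :* (a :- b)) refl a a′ c))
        (∣p*q∣≡∣p∣*∣q∣ c (a - a′))))
      (*-mono (0≤∣p∣ c) δ≥0 c≤ aa′))
    (≤-trans (≤-reflexive (trans
        (cong ∣_∣ (solve 3 (λ a b c → c :* a :- c :* b := c :* (a :- b)) refl c c′ a′))
        (∣p*q∣≡∣p∣*∣q∣ a′ (c - c′))))
      (*-mono (0≤∣p∣ a′) η≥0 a′≤ cc′))

half+half : ∀ ε → ½ * ε + ½ * ε ≡ ε
half+half = solve 1 (λ e → con ½ :* e :+ con ½ :* e := e) refl

third³ : ∀ ε → ⅓ * ε + ⅓ * ε + ⅓ * ε ≡ ε
third³ = solve 1 (λ e → con ⅓ :* e :+ con ⅓ :* e :+ con ⅓ :* e := e) refl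

*-cauchy : (x y : ℝ) → Cauchy (λ n → seq x n * seq y n)
*-cauchy x y ε ε>0 =
  let B , B≥0 , N₁ , hx = bounded x
      C , C≥0 , N₂ , hy = bounded y
      δ , δ>0 , Cδ≤     = shrink C≥0 (*-pos 0<½ ε>0)
      η , η>0 , Bη≤     = shrink B≥0 (*-pos 0<½ ε>0)
      N₃ , cx           = cauchy x δ δ>0
      N₄ , cy           = cauchy y η η>0
      N₁₂               = N₁ ℕ.⊔ N₂
      N₃₄               = N₃ ℕ.⊔ N₄
  in N₁₂ ℕ.⊔ N₃₄ , λ m n N≤m N≤n →
    let N₁₂≤m = ℕₚ.m⊔n≤o⇒m≤o N₁₂ N₃₄ N≤m
        N₃₄≤m = ℕₚ.m⊔n≤o⇒n≤o N₁₂ N₃₄ N≤m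
        N₁₂≤n = ℕₚ.m⊔n≤o⇒m≤o N₁₂ N₃₄ N≤n
        N₃₄≤n = ℕₚ.m⊔n≤o⇒n≤o N₁₂ N₃₄ N≤n
    in ≤-trans
      (*-close {seq x m} {seq x n} {seq y m} {seq y n}
        (hy m (ℕₚ.m⊔n≤o⇒n≤o N₁ N₂ N₁₂≤m))
        (cx m n (ℕₚ.m⊔n≤o⇒m≤o N₃ N₄ N₃₄≤m) (ℕₚ.m⊔n≤o⇒m≤o N₃ N₄ N₃₄≤n)) (<⇒≤ δ>0)
        (hx n (ℕₚ.m⊔n≤o⇒m≤o N₁ N₂ N₁₂≤n))
        (cy m n (ℕₚ.m⊔n≤o⇒n≤o N₃ N₄ N₃₄≤m) (ℕₚ.m⊔n≤o⇒n≤o N₃ N₄ N₃₄≤n)) (<⇒≤ η>0))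
      (≤-trans (+-mono-≤ Cδ≤ Bη≤) (≤-reflexive (half+half ε)))

_*ᵣ_ : ℝ → ℝ → ℝ
x *ᵣ y = mkℝ (λ n → seq x n * seq y n) (*-cauchy x y)

mid : ℚ → ℚ → ℚ
mid a b = ½ * (a + b)

-- Riemann sum of dt / t from a to b over 2ⁿ equal pieces, evaluated at
-- the endpoint of each piece nearer to a; a > b is allowed.
riemann : ℕ → ℚ → ℚ → ℚ
riemann zero    a b = (b - a) * inv a
riemann (suc n) a b = riemann n a (mid a b) + riemann n (mid a b) b

½^_ : ℕ → ℚ
½^ zero  = 1ℚ
½^ suc n = ½ * ½^ n

∣½*∣ : ∀ p → ∣ ½ * p ∣ ≡ ½ * ∣ p ∣
∣½*∣ p = ∣p*q∣≡∣p∣*∣q∣ ½ p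

mid≥ : ∀ {δ a b} → δ ≤ a → δ ≤ b → δ ≤ mid a b
mid≥ {δ} {a} {b} δ≤a δ≤b = subst (_≤ mid a b)
  (solve 1 (λ d → con ½ :* (d :+ d) := d) refl δ)
  (*-monoˡ 0≤½ (+-mono-≤ δ≤a δ≤b))

mid-a : ∀ a b → mid a b - a ≡ ½ * (b - a)
mid-a = solve 2 (λ a b → con ½ :* (a :+ b) :- a := con ½ :* (b :- a)) refl

b-mid : ∀ a b → b - mid a b ≡ ½ * (b - a)
b-mid = solve 2 (λ a b → b :- con ½ :* (a :+ b) := con ½ :* (b :- a)) refl

module _ {δ : ℚ} (δ>0 : 0ℚ < δ) where

  D : ℚ
  D = inv δ * inv δ

  D≥0 : 0ℚ ≤ D
  D≥0 = *-nn (inv≥0 δ>0) (inv≥0 δ>0)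

  inv²≤D : ∀ {a b} → δ ≤ a → δ ≤ b → ∣ inv a * inv b ∣ ≤ D
  inv²≤D {a} {b} δ≤a δ≤b = subst (_≤ D)
    (sym (0≤p⇒∣p∣≡p (*-nn ia≥0 ib≥0)))
    (*-mono ia≥0 (inv≥0 δ>0) (inv-anti δ>0 δ≤a) (inv-anti δ>0 δ≤b))
    where
    ia≥0 : 0ℚ ≤ inv a
    ia≥0 = inv≥0 (<-≤-trans δ>0 δ≤a)
    ib≥0 : 0ℚ ≤ inv b
    ib≥0 = inv≥0 (<-≤-trans δ>0 δ≤b)

  -- The cross term b a′ - b′ a is halved by each bisection.
  lipschitz : ∀ n {a b a′ b′} → δ ≤ a → δ ≤ b → δ ≤ a′ → δ ≤ b′ →
              ∣ riemann n a b - riemann n a′ b′ ∣ ≤ ∣ b * a′ - b′ * a ∣ * D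
  lipschitz zero {a} {b} {a′} {b′} δ≤a δ≤b δ≤a′ δ≤b′ = ≤-trans
    (≤-reflexive (trans (cong ∣_∣ identity) (∣p*q∣≡∣p∣*∣q∣ (b * a′ - b′ * a) (i * i′))))
    (*-monoˡ (0≤∣p∣ (b * a′ - b′ * a)) (inv²≤D δ≤a δ≤a′))
    where
    i i′ : ℚ
    i  = inv a
    i′ = inv a′
    identity : (b - a) * i - (b′ - a′) * i′ ≡ (b * a′ - b′ * a) * (i * i′)
    identity = trans
      (solve 6 (λ a b a′ b′ i i′ → (b :- a) :* i :- (b′ :- a′) :* i′
                  := (b :* i :- b′ :* i′) :+ (a′ :* i′ :- a :* i)) refl a b a′ b′ i i′)
      (trans (cong₂ (λ u v → (b * i - b′ * i′) + (u - v))
               (*-inv (<-≤-trans δ>0 δ≤a′)) (*-inv (<-≤-trans δ>0 δ≤a)))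
      (trans (solve 2 (λ x y → (x :- y) :+ (con 1ℚ :- con 1ℚ) := x :* con 1ℚ :- y :* con 1ℚ)
               refl (b * i) (b′ * i′))
      (trans (sym (cong₂ (λ u v → b * i * u - b′ * i′ * v)
               (*-inv (<-≤-trans δ>0 δ≤a′)) (*-inv (<-≤-trans δ>0 δ≤a))))
      (solve 6 (λ a b a′ b′ i i′ → b :* i :* (a′ :* i′) :- b′ :* i′ :* (a :* i)
                  := (b :* a′ :- b′ :* a) :* (i :* i′)) refl a b a′ b′ i i′))))
  lipschitz (suc n) {a} {b} {a′} {b′} δ≤a δ≤b δ≤a′ δ≤b′ = ≤-trans
    (tri₂ {riemann n a m} {riemann n m b} {riemann n a′ m′} {riemann n m′ b′}
      (lipschitz n δ≤a δ≤m δ≤a′ δ≤m′) (lipschitz n δ≤m δ≤b δ≤m′ δ≤b′))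
    (≤-reflexive (trans
      (cong₂ (λ u v → u * D + v * D)
        (trans (cong ∣_∣ (solve 4 (λ a b a′ b′ →
            con ½ :* (a :+ b) :* a′ :- con ½ :* (a′ :+ b′) :* a
            := con ½ :* (b :* a′ :- b′ :* a)) refl a b a′ b′))
          (∣½*∣ c))
        (trans (cong ∣_∣ (solve 4 (λ a b a′ b′ →
            b :* (con ½ :* (a′ :+ b′)) :- b′ :* (con ½ :* (a :+ b))
            := con ½ :* (b :* a′ :- b′ :* a)) refl a b a′ b′))
          (∣½*∣ c)))
      (solve 2 (λ x d → con ½ :* x :* d :+ con ½ :* x :* d := x :* d) refl ∣ c ∣ D)))
    where
    m m′ c : ℚ
    m  = mid a b
    m′ = mid a′ b′
    c  = b * a′ - b′ * a
    δ≤m : δ ≤ m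
    δ≤m = mid≥ δ≤a δ≤b
    δ≤m′ : δ ≤ m′
    δ≤m′ = mid≥ δ≤a′ δ≤b′

  Q : ℚ → ℚ → ℚ
  Q a b = ∣ b - a ∣ * ∣ b - a ∣ * D

  Q≥0 : ∀ a b → 0ℚ ≤ Q a b
  Q≥0 a b = *-nn (*-nn (0≤∣p∣ (b - a)) (0≤∣p∣ (b - a))) D≥0

  ¼ : ℚ
  ¼ = ½ * ½

  Q-half : ∀ {x a b} → x ≡ ½ * (b - a) → ∣ x ∣ * ∣ x ∣ * D ≡ ¼ * Q a b
  Q-half {x} {a} {b} refl = trans
    (cong (λ u → u * u * D) (∣½*∣ (b - a)))
    (solve 2 (λ x d → con ½ :* x :* (con ½ :* x) :* d := con ½ :* con ½ :* (x :* x :* d))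
      refl ∣ b - a ∣ D)

  bisect : ∀ {a b} → δ ≤ a → δ ≤ b → ∣ riemann 1 a b - riemann 0 a b ∣ ≤ ¼ * Q a b
  bisect {a} {b} δ≤a δ≤b = ≤-trans
    (≤-reflexive (trans (cong ∣_∣ identity)
      (trans (∣p*q∣≡∣p∣*∣q∣ ((b - m) * (a - m)) (i * j))
      (cong (_* ∣ i * j ∣) (trans (∣p*q∣≡∣p∣*∣q∣ (b - m) (a - m))
        (cong (∣ b - m ∣ *_) (trans (∣∣-sym a m)
          (cong ∣_∣ (trans (mid-a a b) (sym (b-mid a b)))))))))))
    (≤-trans (*-monoˡ (*-nn (0≤∣p∣ (b - m)) (0≤∣p∣ (b - m))) (inv²≤D δ≤a δ≤m))
      (≤-reflexive (Q-half {x = b - m} {a} {b} (b-mid a b))))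
    where
    m i j : ℚ
    m = mid a b
    i = inv a
    j = inv m
    δ≤m : δ ≤ m
    δ≤m = mid≥ δ≤a δ≤b
    identity : (m - a) * i + (b - m) * j - (b - a) * i ≡ (b - m) * (a - m) * (i * j)
    identity = trans
      (solve 5 (λ a b m i j → (m :- a) :* i :+ (b :- m) :* j :- (b :- a) :* i
          := (b :- m) :* (j :* con 1ℚ :- i :* con 1ℚ)) refl a b m i j)
      (trans (sym (cong₂ (λ u v → (b - m) * (j * u - i * v))
          (*-inv (<-≤-trans δ>0 δ≤a)) (*-inv (<-≤-trans δ>0 δ≤m))))
      (solve 5 (λ a b m i j → (b :- m) :* (j :* (a :* i) :- i :* (m :* j))
          := (b :- m) :* (a :- m) :* (i :* j)) refl a b m i j))

  refine₀ : ∀ k {a b} → δ ≤ a → δ ≤ b → ∣ riemann k a b - riemann 0 a b ∣ ≤ Q a b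
  refine₀ zero {a} {b} δ≤a δ≤b = subst (λ w → ∣ w ∣ ≤ Q a b)
    (sym (+-inverseʳ (riemann 0 a b))) (Q≥0 a b)
  refine₀ (suc k) {a} {b} δ≤a δ≤b = ≤-trans
    (tri {riemann (suc k) a b} {riemann 1 a b} {riemann 0 a b}
      (tri₂ {riemann k a m} {riemann k m b} {riemann 0 a m} {riemann 0 m b}
        (refine₀ k δ≤a δ≤m) (refine₀ k δ≤m δ≤b))
      (bisect δ≤a δ≤b))
    (≤-trans
      (≤-reflexive (cong₂ (λ u v → (u + v) + ¼ * Q a b)
        (Q-half {a = a} {b} (mid-a a b)) (Q-half {a = a} {b} (b-mid a b))))
      (subst (λ w → (¼ * Q a b + ¼ * Q a b) + ¼ * Q a b ≤ w)
        (solve 1 (λ q → (con ¼ :* q :+ con ¼ :* q) :+ (con ¼ :* q :+ con ¼ :* q) := q) refl (Q a b))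
        (+-monoʳ-≤ (¼ * Q a b + ¼ * Q a b)
          (subst (_≤ ¼ * Q a b + ¼ * Q a b) (+-identityʳ (¼ * Q a b))
            (+-monoʳ-≤ (¼ * Q a b) (*-nn (nonNegative⁻¹ ¼) (Q≥0 a b)))))))
    where
    m : ℚ
    m = mid a b
    δ≤m : δ ≤ m
    δ≤m = mid≥ δ≤a δ≤b

  refine : ∀ n k {a b} → δ ≤ a → δ ≤ b →
           ∣ riemann (n ℕ.+ k) a b - riemann n a b ∣ ≤ Q a b * ½^ n
  refine zero k {a} {b} δ≤a δ≤b =
    subst (∣ riemann k a b - riemann 0 a b ∣ ≤_) (sym (*-identityʳ (Q a b))) (refine₀ k δ≤a δ≤b)
  refine (suc n) k {a} {b} δ≤a δ≤b = ≤-trans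
    (tri₂ {riemann (n ℕ.+ k) a m} {riemann (n ℕ.+ k) m b} {riemann n a m} {riemann n m b}
      (refine n k δ≤a δ≤m) (refine n k δ≤m δ≤b))
    (≤-reflexive (trans
      (cong₂ (λ u v → u * ½^ n + v * ½^ n)
        (Q-half {a = a} {b} (mid-a a b)) (Q-half {a = a} {b} (b-mid a b)))
      (solve 2 (λ q h → con ¼ :* q :* h :+ con ¼ :* q :* h := q :* (con ½ :* h))
        refl (Q a b) (½^ n))))
    where
    m : ℚ
    m = mid a b
    δ≤m : δ ≤ m
    δ≤m = mid≥ δ≤a δ≤b

½^≥0 : ∀ n → 0ℚ ≤ ½^ n
½^≥0 zero    = <⇒≤ 0<1
½^≥0 (suc n) = *-nn 0≤½ (½^≥0 n)

½^≤1 : ∀ n → ½^ n ≤ 1ℚ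
½^≤1 zero    = ≤-refl
½^≤1 (suc n) = *-mono {½} {1ℚ} {½^ n} {1ℚ} 0≤½ (<⇒≤ 0<1) (ℚ.*≤* (ℤ.+≤+ (ℕ.s≤s ℕ.z≤n))) (½^≤1 n)

toℚᵘ-/1 : ∀ n → ℚ.toℚᵘ (+ n / 1) ℚᵘ.≃ ℚᵘ.mkℚᵘ (+ n) 0
toℚᵘ-/1 n = toℚᵘ-fromℚᵘ (ℚᵘ.mkℚᵘ (+ n) 0)

/1-mono : ∀ {m n} → m ℕ.≤ n → + m / 1 ≤ + n / 1
/1-mono {m} {n} m≤n = toℚᵘ-cancel-≤
  (ℚᵘₚ.≤-respˡ-≃ (ℚᵘₚ.≃-sym (toℚᵘ-/1 m)) (ℚᵘₚ.≤-respʳ-≃ (ℚᵘₚ.≃-sym (toℚᵘ-/1 n))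
    (ℚᵘ.*≤* (ℤₚ.*-monoʳ-≤-nonNeg (+ 1) (ℤ.+≤+ m≤n)))))

/1-suc : ∀ n → + suc n / 1 ≡ + n / 1 + 1ℚ
/1-suc n = toℚᵘ-injective (ℚᵘₚ.≃-trans (toℚᵘ-/1 (suc n)) (ℚᵘₚ.≃-trans
  (ℚᵘ.*≡* (cong (ℤ._* + 1) (trans (cong +_ (ℕₚ.+-comm 1 n))
    (cong (ℤ._+ + 1) (sym (ℤₚ.*-identityʳ (+ n)))))))
  (ℚᵘₚ.≃-sym (ℚᵘₚ.≃-trans (toℚᵘ-homo-+ (+ n / 1) 1ℚ)
    (ℚᵘₚ.+-congˡ (ℚ.toℚᵘ 1ℚ) (toℚᵘ-/1 n))))))

archimedes : ∀ p → ∃[ N ] p ≤ + N / 1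
archimedes p@(mkℚ i d-1 _) = ℤ.∣ i ∣ , toℚᵘ-cancel-≤
  (ℚᵘₚ.≤-respʳ-≃ (ℚᵘₚ.≃-sym (toℚᵘ-/1 ℤ.∣ i ∣)) (ℚᵘ.*≤* (begin
    i ℤ.* + 1                    ≡⟨ ℤₚ.*-identityʳ i ⟩
    i                            ≤⟨ i≤∣i∣ i ⟩
    + ℤ.∣ i ∣                    ≤⟨ ℤ.+≤+ (ℕₚ.m≤m*n ℤ.∣ i ∣ (suc d-1)) ⟩
    + (ℤ.∣ i ∣ ℕ.* suc d-1)      ≡⟨ ℤₚ.pos-* ℤ.∣ i ∣ (suc d-1) ⟩
    + ℤ.∣ i ∣ ℤ.* + suc d-1      ∎)))
  where
  open ℤₚ.≤-Reasoning
  i≤∣i∣ : ∀ i → i ℤ.≤ + ℤ.∣ i ∣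
  i≤∣i∣ (+ n)        = ℤₚ.≤-refl
  i≤∣i∣ (ℤ.-[1+ n ]) = ℤ.-≤+

n*½^n≤1 : ∀ n → + n / 1 * ½^ n ≤ 1ℚ
n*½^n≤1 zero    = <⇒≤ 0<1
n*½^n≤1 (suc n) = ≤-trans
  (≤-reflexive (trans (cong (_* ½^ suc n) (/1-suc n))
    (solve 2 (λ k h → (k :+ con 1ℚ) :* (con ½ :* h) := con ½ :* (k :* h :+ h)) refl (+ n / 1) (½^ n))))
  (*-monoˡ {+ n / 1 * ½^ n + ½^ n} {1ℚ + 1ℚ} {½} 0≤½ (+-mono-≤ (n*½^n≤1 n) (½^≤1 n)))

½^-small : ∀ K {ε} → 0ℚ < ε → ∃[ N ] (∀ n → N ℕ.≤ n → K * ½^ n ≤ ε)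
½^-small K {ε} ε>0 =
  let N , h = archimedes (K * inv ε)
  in N , λ n N≤n → ≤-trans
    (≤-reflexive (trans (sym (*-identityʳ (K * ½^ n))) (trans
      (cong (K * ½^ n *_) (sym (*-inv ε>0)))
      (solve 4 (λ k h e i → k :* h :* (e :* i) := e :* (k :* i :* h)) refl K (½^ n) ε (inv ε)))))
    (≤-trans
      (*-monoˡ {K * inv ε * ½^ n} {1ℚ} {ε} (<⇒≤ ε>0)
        (≤-trans (*-monoʳ {K * inv ε} {+ n / 1} {½^ n} (½^≥0 n) (≤-trans h (/1-mono N≤n))) (n*½^n≤1 n)))
      (≤-reflexive (*-identityʳ ε)))

below : ∀ {p} → 0ℚ < p → ∃[ δ ] 0ℚ < δ × δ ≤ p × δ ≤ 1ℚ
below {p} p>0 with p ≤? 1ℚ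
... | yes p≤1 = p , p>0 , ≤-refl , p≤1
... | no  p≰1 = 1ℚ , 0<1 , <⇒≤ (≰⇒> p≰1) , ≤-refl

Q≤ : ∀ {δ x B} (δ>0 : 0ℚ < δ) → 0ℚ ≤ B → ∣ x ∣ ≤ B → Q δ>0 1ℚ x ≤ (B + 1ℚ) * (B + 1ℚ) * D δ>0
Q≤ {δ} {x} {B} δ>0 B≥0 x≤B =
  *-monoʳ {∣ x - 1ℚ ∣ * ∣ x - 1ℚ ∣} {(B + 1ℚ) * (B + 1ℚ)} {D δ>0} (D≥0 δ>0)
    (*-mono {∣ x - 1ℚ ∣} {B + 1ℚ} (0≤∣p∣ (x - 1ℚ)) (+-nn B≥0 (<⇒≤ 0<1)) h h)
  where
  h : ∣ x - 1ℚ ∣ ≤ B + 1ℚ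
  h = ≤-trans (∣p-q∣≤∣p∣+∣q∣ x 1ℚ) (+-monoˡ-≤ 1ℚ x≤B)

riemann-close : ∀ {δ} (δ>0 : 0ℚ < δ) → δ ≤ 1ℚ → ∀ N {m n} → N ℕ.≤ m → N ℕ.≤ n →
  ∀ {x y} → δ ≤ x → δ ≤ y →
  ∣ riemann m 1ℚ x - riemann n 1ℚ y ∣ ≤
    Q δ>0 1ℚ x * ½^ N + ∣ x - y ∣ * D δ>0 + Q δ>0 1ℚ y * ½^ N
riemann-close {δ} δ>0 δ≤1 N {m} {n} N≤m N≤n {x} {y} δ≤x δ≤y =
  tri {riemann m 1ℚ x} {riemann N 1ℚ y} {riemann n 1ℚ y}
    (tri {riemann m 1ℚ x} {riemann N 1ℚ x} {riemann N 1ℚ y}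
      (refine′ N≤m δ≤x)
      (subst (λ w → ∣ riemann N 1ℚ x - riemann N 1ℚ y ∣ ≤ ∣ w ∣ * D δ>0)
        (cong₂ _-_ (*-identityʳ x) (*-identityʳ y))
        (lipschitz δ>0 N δ≤1 δ≤x δ≤1 δ≤y)))
    (subst (_≤ Q δ>0 1ℚ y * ½^ N) (∣∣-sym (riemann n 1ℚ y) (riemann N 1ℚ y)) (refine′ N≤n δ≤y))
  where
  refine′ : ∀ {m z} → N ℕ.≤ m → δ ≤ z → ∣ riemann m 1ℚ z - riemann N 1ℚ z ∣ ≤ Q δ>0 1ℚ z * ½^ N
  refine′ {m} {z} N≤m δ≤z = subst
    (λ k → ∣ riemann k 1ℚ z - riemann N 1ℚ z ∣ ≤ Q δ>0 1ℚ z * ½^ N)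
    (ℕₚ.m+[n∸m]≡n N≤m) (refine δ>0 N (m ℕ.∸ N) δ≤1 δ≤z)

log-cauchy : (x : ℝ) → 0ᵣ <ᵣ x → Cauchy (λ n → riemann n 1ℚ (seq x n))
log-cauchy x (δ₀ , δ₀>0 , N₁ , hδ) ε ε>0 =
  let δ , δ>0 , δ≤δ₀ , δ≤1 = below δ₀>0
      B , B≥0 , N₂ , hB    = bounded x
      K                    = (B + 1ℚ) * (B + 1ℚ) * D δ>0
      ε/3>0                = *-pos 0<⅓ ε>0
      N₃ , h½              = ½^-small K ε/3>0
      η , η>0 , Dη≤        = shrink (D≥0 δ>0) ε/3>0
      N₄ , cx              = cauchy x η η>0
      N₁₂                  = N₁ ℕ.⊔ N₂
      N₃₄                  = N₃ ℕ.⊔ N₄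
      N                    = N₁₂ ℕ.⊔ N₃₄
      N₃₄≤N                = ℕₚ.m≤n⊔m N₁₂ N₃₄
      N₁≤N                 = ℕₚ.≤-trans (ℕₚ.m≤m⊔n N₁ N₂) (ℕₚ.m≤m⊔n N₁₂ N₃₄)
      N₂≤N                 = ℕₚ.≤-trans (ℕₚ.m≤n⊔m N₁ N₂) (ℕₚ.m≤m⊔n N₁₂ N₃₄)
      N₃≤N                 = ℕₚ.≤-trans (ℕₚ.m≤m⊔n N₃ N₄) N₃₄≤N
      N₄≤N                 = ℕₚ.≤-trans (ℕₚ.m≤n⊔m N₃ N₄) N₃₄≤N
      lower : ∀ k → N ℕ.≤ k → δ ≤ seq x k
      lower k N≤k = ≤-trans δ≤δ₀ (subst (_≤ seq x k) (+-identityˡ δ₀) (hδ k (ℕₚ.≤-trans N₁≤N N≤k)))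
      edge : ∀ k → N ℕ.≤ k → Q δ>0 1ℚ (seq x k) * ½^ N ≤ ⅓ * ε
      edge k N≤k = ≤-trans
        (*-monoʳ {Q δ>0 1ℚ (seq x k)} {K} {½^ N} (½^≥0 N)
          (Q≤ δ>0 B≥0 (hB k (ℕₚ.≤-trans N₂≤N N≤k))))
        (h½ N N₃≤N)
  in N , λ m n N≤m N≤n → ≤-trans
    (riemann-close δ>0 δ≤1 N N≤m N≤n (lower m N≤m) (lower n N≤n))
    (≤-trans
      (+-mono-≤
        (+-mono-≤ (edge m N≤m)
          (≤-trans
            (*-monoʳ {∣ seq x m - seq x n ∣} {η} {D δ>0} (D≥0 δ>0)
              (cx m n (ℕₚ.≤-trans N₄≤N N≤m) (ℕₚ.≤-trans N₄≤N N≤n)))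
            (≤-trans (≤-reflexive (*-comm η (D δ>0))) Dη≤)))
        (edge n N≤n))
      (≤-reflexive (third³ ε)))

-- log x = ∫₁ˣ dt / t.  The sequence does not depend on the proof of 0 < x,
-- which only serves to make it Cauchy.
log : (x : ℝ) → 0ᵣ <ᵣ x → ℝ
log x x>0 = mkℝ (λ n → riemann n 1ℚ (seq x n)) (log-cauchy x x>0)

riemann-lower : ∀ n {a b} → 0ℚ < a → a ≤ b → (b - a) * inv b ≤ riemann n a b
riemann-lower zero {a} {b} a>0 a≤b =
  *-monoˡ {inv b} {inv a} {b - a} (subst (_≤ b - a) (+-inverseʳ a) (+-monoˡ-≤ (- a) a≤b)) (inv-anti a>0 a≤b)
riemann-lower (suc n) {a} {b} a>0 a≤b = ≤-trans
  (≤-trans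
    (≤-reflexive (solve 4 (λ a b m i → (b :- a) :* i := (m :- a) :* i :+ (b :- m) :* i) refl a b m (inv b)))
    (+-monoˡ-≤ ((b - m) * inv b)
      (*-monoˡ {inv b} {inv m} {m - a} (subst (_≤ m - a) (+-inverseʳ a) (+-monoˡ-≤ (- a) a≤m))
        (inv-anti m>0 m≤b))))
  (+-mono-≤ (riemann-lower n a>0 a≤m) (riemann-lower n m>0 m≤b))
  where
  m : ℚ
  m = mid a b
  a≤m : a ≤ m
  a≤m = mid≥ ≤-refl a≤b
  m≤b : m ≤ b
  m≤b = subst (m ≤_) (half+half b)
    (≤-trans (≤-reflexive (*-distribˡ-+ ½ a b)) (+-monoˡ-≤ (½ * b) (*-monoˡ {a} {b} {½} 0≤½ a≤b)))
  m>0 : 0ℚ < m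
  m>0 = <-≤-trans a>0 a≤m

0<fromℕ : ∀ {n} → 1 ℕ.≤ n → 0ᵣ <ᵣ fromℕ n
0<fromℕ {n} 1≤n = 1ℚ , 0<1 , 0 , λ _ _ → /1-mono 1≤n

0<log : ∀ {n} → 2 ℕ.≤ n → (n>0 : 0ᵣ <ᵣ fromℕ n) → 0ᵣ <ᵣ log (fromℕ n) n>0
0<log {n} 2≤n _ = (q - 1ℚ) * inv q , *-pos q-1>0 (inv>0 q>0) , 0 , λ k _ →
  subst (_≤ riemann k 1ℚ q) (sym (+-identityˡ ((q - 1ℚ) * inv q))) (riemann-lower k 0<1 1≤q)
  where
  q : ℚ
  q = + n / 1
  1≤q : 1ℚ ≤ q
  1≤q = /1-mono (ℕₚ.<⇒≤ 2≤n)
  q>0 : 0ℚ < q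
  q>0 = <-≤-trans 0<1 1≤q
  q-1>0 : 0ℚ < q - 1ℚ
  q-1>0 = <-≤-trans 0<1 (+-monoˡ-≤ (- 1ℚ) (/1-mono 2≤n))

{-# OPTIONS --safe #-}

-- For a residue d let Φ(d) = Σ_{x<n} min(T, ⌊n / (x · (x d mod n))⌋).  The
-- quotient of a Euclidean step with remainders a > b and continuant X satisfies
-- q ≤ ⌊n / (X b)⌋ with X d ≡ ± b mod n, and X increases, so the sum of all
-- quotients is at most 2 (Φ(d) + Φ(n - d)) as long as Φ(d) + Φ(n - d) < T: then
-- no term has been truncated.  For fixed x at most B residues d have
-- 1 ≤ x d mod n ≤ B, hence Σ_d Φ(d) is O(n log n log T), and some d coprime to n
-- has Φ(d) + Φ(n - d) = O(n/φ(n) log n log T).  This is below T for some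
-- T = O(n/φ(n) log n log log n), because n/φ(n) = O(log n).
module Submission where

open import Data.Integer using (+_)
open import Data.Nat using (ℕ; _≤_; _∸_)
open import Data.Nat.GCD using (gcd)
open import Data.Nat.Properties using (<⇒≤)
open import Data.Product using (Σ-syntax; ∃-syntax; _×_)
open import Data.Rational using (_/_)
open import Relation.Binary.PropositionalEquality using (_≡_)
open import Defs using (ℝ; fromℚ; fromℕ; 0<fromℕ; _*ᵣ_; _≤ᵣ_; log; 0<log; φ; φ-nonZero; s)

import Data.Integer as ℤ
import Data.Integer.Properties as ℤₚ
open import Data.List using ([]; _∷_; filter; length; map; applyUpTo)
open import Data.List.Relation.Unary.All using (_∷_)
import Data.Nat as ℕ
open import Data.Nat using (zero; suc; _+_; _*_; _^_; _<_; _≤?_; _≟_; _%_; z≤n; s≤s; NonZero)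
open import Data.Nat.Coprimality using (Coprime; coprime?; coprime-divisor; 0-coprimeTo-m⇒m≡1; coprime⇒gcd≡1)
import Data.Nat.Coprimality as Coprimality
open import Data.Nat.DivMod hiding (_/_)
open import Data.Nat.Divisibility
open import Data.Nat.GCD using (gcd[m,n]∣m; gcd[m,n]∣n; gcd-greatest; c*gcd[m,n]≡gcd[cm,cn])
open import Data.Nat.Induction using (Acc; acc; <-wellFounded)
open import Data.Nat.ListAction using (sum; product)
open import Data.Nat.Primality using (Prime; prime?; prime⇒irreducible; prime⇒nonTrivial)
open import Data.Nat.Primality.Factorisation using (factorise)
open import Data.Nat.Properties
open import Data.Nat.Tactic.RingSolver using (solve-∀)
open import Data.Product using (_,_)
open import Data.Rational using (ℚ; 0ℚ; 1ℚ; ½)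
import Data.Rational as ℚ
import Data.Rational.Properties as ℚₚ
open import Data.Rational.Solver using (module +-*-Solver)
import Data.Rational.Unnormalised as ℚᵘ
import Data.Rational.Unnormalised.Properties as ℚᵘₚ
open import Data.Sum using (inj₁; inj₂)
open import Function using (_∘_; id)
open import Relation.Binary.PropositionalEquality
open import Relation.Nullary
open import Relation.Nullary.Decidable using (from-yes)
open import Defs using (quotients-acc; inv; *-inv; inv≥0; mid; mid≥; riemann; riemann-lower; toℚᵘ-/1; /1-mono; /1-suc; *-mono; *-monoˡ; *-monoʳ; *-nn; *-pos; 0<½; 0≤½; 0<1)

open +-*-Solver using (solve; con; _:=_; _:+_; _:*_; _:-_)

-- Finite sums and counting

-- The truncation at T is what makes the second logarithm a log log. Writing min(T, ⌊n / (x r)⌋) as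
-- the number of levels t with 1 ≤ t ≤ T and t x r ≤ n, the sum over d costs about n / (x t) for
-- each level, so the levels contribute a harmonic sum of length T; without truncation its length
-- would be of order n / x and only log² n would come out. The price is circular: truncated sums
-- control the quotients only if some d keeps its total below T, while the average to be beaten
-- itself contains log T. A T of order (n/φ(n)) log n log T is consistent once T is known to be at
-- most a power of log n, and for that a crude bound on n/φ(n) is enough, because it enters only
-- through log T. Throughout the counting, logarithms are exponents of 2; integrals replace them
-- only at the end.

𝟙 : ∀ {P : Set} → Dec P → ℕ
𝟙 (yes _) = 1
𝟙 (no  _) = 0

𝟙-yes : ∀ {P : Set} (P? : Dec P) → P → 𝟙 P? ≡ 1
𝟙-yes (yes _) _ = refl
𝟙-yes (no ¬p) p = contradiction p ¬p

𝟙-no : ∀ {P : Set} (P? : Dec P) → ¬ P → 𝟙 P? ≡ 0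
𝟙-no (yes p) ¬p = contradiction p ¬p
𝟙-no (no _)  _  = refl

𝟙-mono : ∀ {P Q : Set} (P? : Dec P) (Q? : Dec Q) → (P → Q) → 𝟙 P? ≤ 𝟙 Q?
𝟙-mono (yes p) Q? f = ≤-reflexive (sym (𝟙-yes Q? (f p)))
𝟙-mono (no _)  _  _ = z≤n

𝟙-cong : ∀ {P Q : Set} (P? : Dec P) (Q? : Dec Q) → (P → Q) → (Q → P) → 𝟙 P? ≡ 𝟙 Q?
𝟙-cong P? Q? f g = ≤-antisym (𝟙-mono P? Q? f) (𝟙-mono Q? P? g)

∑ : ℕ → (ℕ → ℕ) → ℕ
∑ zero    f = 0
∑ (suc n) f = ∑ n f + f n

∑-mono : ∀ n {f g : ℕ → ℕ} → (∀ i → i < n → f i ≤ g i) → ∑ n f ≤ ∑ n g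
∑-mono zero    h = z≤n
∑-mono (suc n) h = +-mono-≤ (∑-mono n (λ i i<n → h i (m<n⇒m<1+n i<n))) (h n ≤-refl)

∑-cong : ∀ n {f g : ℕ → ℕ} → (∀ i → i < n → f i ≡ g i) → ∑ n f ≡ ∑ n g
∑-cong zero    h = refl
∑-cong (suc n) h = cong₂ _+_ (∑-cong n (λ i i<n → h i (m<n⇒m<1+n i<n))) (h n ≤-refl)

∑-+ : ∀ n (f g : ℕ → ℕ) → ∑ n (λ i → f i + g i) ≡ ∑ n f + ∑ n g
∑-+ zero    f g = refl
∑-+ (suc n) f g = trans (cong (_+ (f n + g n)) (∑-+ n f g)) (interchange (∑ n f) (∑ n g) (f n) (g n))
  where
  interchange : ∀ a b c d → a + b + (c + d) ≡ a + c + (b + d)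
  interchange = solve-∀

∑-*ʳ : ∀ n (f : ℕ → ℕ) c → ∑ n (λ i → f i * c) ≡ ∑ n f * c
∑-*ʳ zero    f c = refl
∑-*ʳ (suc n) f c = trans (cong (_+ f n * c) (∑-*ʳ n f c)) (sym (*-distribʳ-+ c (∑ n f) (f n)))

∑-const : ∀ n c → ∑ n (λ _ → c) ≡ n * c
∑-const zero    c = refl
∑-const (suc n) c = trans (cong (_+ c) (∑-const n c)) (+-comm (n * c) c)

∑-swap : ∀ m n (f : ℕ → ℕ → ℕ) → ∑ m (λ i → ∑ n (f i)) ≡ ∑ n (λ j → ∑ m (λ i → f i j))
∑-swap zero    n f = sym (trans (∑-const n 0) (*-zeroʳ n))
∑-swap (suc m) n f = trans (cong (_+ ∑ n (f m)) (∑-swap m n f)) (sym (∑-+ n (λ j → ∑ m (λ i → f i j)) (f m)))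

∑-append : ∀ m n (f : ℕ → ℕ) → ∑ (m + n) f ≡ ∑ m f + ∑ n (λ i → f (m + i))
∑-append m zero    f = trans (cong (λ k → ∑ k f) (+-identityʳ m)) (sym (+-identityʳ _))
∑-append m (suc n) f = trans (cong (λ k → ∑ k f) (+-suc m n))
  (trans (cong (_+ f (m + n)) (∑-append m n f)) (+-assoc (∑ m f) _ _))

∑-blocks : ∀ m p (f : ℕ → ℕ) → ∑ (m * p) f ≡ ∑ m (λ j → ∑ p (λ r → f (j * p + r)))
∑-blocks zero    p f = refl
∑-blocks (suc m) p f = trans (cong (λ k → ∑ k f) (+-comm p (m * p)))
  (trans (∑-append (m * p) p f) (cong (_+ ∑ p (λ r → f (m * p + r))) (∑-blocks m p f)))

∑-monoˡ : ∀ {m n} (f : ℕ → ℕ) → m ≤ n → ∑ m f ≤ ∑ n f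
∑-monoˡ {m} {n} f m≤n = ≤-trans (m≤m+n (∑ m f) _)
  (≤-reflexive (trans (sym (∑-append m (n ∸ m) f)) (cong (λ k → ∑ k f) (m+[n∸m]≡n m≤n))))

∑-term : ∀ {n i} (f : ℕ → ℕ) → i < n → f i ≤ ∑ n f
∑-term f i<n = ≤-trans (m≤n+m _ _) (∑-monoˡ f i<n)

∑-head : ∀ n (f : ℕ → ℕ) → ∑ (suc n) f ≡ f 0 + ∑ n (f ∘ suc)
∑-head n f = ∑-append 1 n f

∑-reverse : ∀ n (f : ℕ → ℕ) → ∑ n (λ i → f (n ∸ i)) ≡ ∑ n (f ∘ suc)
∑-reverse zero    f = refl
∑-reverse (suc n) f = trans (∑-head n (λ i → f (suc n ∸ i)))
  (trans (cong (f (suc n) ℕ.+_) (∑-reverse n f)) (+-comm (f (suc n)) _))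

-- A cyclic shift only trades the term at 0 for the term at n.
∑-shift : ∀ n (f : ℕ → ℕ) → f 0 ≡ f n → ∑ n (f ∘ suc) ≡ ∑ n f
∑-shift n f f0≡fn = +-cancelˡ-≡ (f 0) _ _
  (trans (sym (∑-head n f)) (trans (cong (∑ n f ℕ.+_) (sym f0≡fn)) (+-comm _ (f 0))))

∑-exists-< : ∀ n (f g : ℕ → ℕ) → ∑ n f < ∑ n g → ∃[ i ] i < n × f i < g i
∑-exists-< zero    f g ()
∑-exists-< (suc n) f g ∑f<∑g with f n ℕ.<? g n
... | yes fn<gn = n , ≤-refl , fn<gn
... | no  fn≮gn =
  let i , i<n , fi<gi = ∑-exists-< n f g (+-cancelʳ-< (f n) _ _
                          (<-≤-trans ∑f<∑g (+-monoʳ-≤ (∑ n g) (≮⇒≥ fn≮gn))))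
  in i , m<n⇒m<1+n i<n , fi<gi

count-unique : ∀ n {P : ℕ → Set} (P? : ∀ i → Dec (P i)) →
  (∀ {i j} → i < n → j < n → P i → P j → i ≡ j) → ∑ n (𝟙 ∘ P?) ≤ 1
count-unique zero    P? unique = z≤n
count-unique (suc n) P? unique with P? n
... | no  _  = ≤-trans (≤-reflexive (+-identityʳ _))
  (count-unique n P? (λ i<n j<n → unique (m<n⇒m<1+n i<n) (m<n⇒m<1+n j<n)))
... | yes pn = ≤-reflexive (cong (_+ 1) (trans
  (∑-cong n (λ i i<n → 𝟙-no (P? i) (λ pi → <⇒≢ i<n (unique (m<n⇒m<1+n i<n) ≤-refl pi pn))))
  (trans (∑-const n 0) (*-zeroʳ n))))

-- Double counting: an admissible i lies in the fibre of `f` over one value below B, and injectivity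
-- leaves at most one i in each fibre.
count-injection : ∀ n B {P : ℕ → Set} (P? : ∀ i → Dec (P i)) (f : ℕ → ℕ) →
  (∀ {i} → i < n → P i → f i < B) →
  (∀ {i j} → i < n → j < n → P i → P j → f i ≡ f j → i ≡ j) →
  ∑ n (𝟙 ∘ P?) ≤ B
count-injection n B P? f f<B f-inj = begin
  ∑ n (𝟙 ∘ P?)                                         ≤⟨ ∑-mono n fibre ⟩
  ∑ n (λ i → ∑ B (λ b → 𝟙 (P? i ×-dec f i ≟ b)))       ≡⟨ ∑-swap n B _ ⟩
  ∑ B (λ b → ∑ n (λ i → 𝟙 (P? i ×-dec f i ≟ b)))       ≤⟨ ∑-mono B (λ b _ → count-unique n _
      (λ i<n j<n (pi , fi≡b) (pj , fj≡b) → f-inj i<n j<n pi pj (trans fi≡b (sym fj≡b)))) ⟩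
  ∑ B (λ _ → 1)                                        ≡⟨ ∑-const B 1 ⟩
  B * 1                                                ≡⟨ *-identityʳ B ⟩
  B                                                    ∎
  where
  open ≤-Reasoning
  fibre : ∀ i → i < n → 𝟙 (P? i) ≤ ∑ B (λ b → 𝟙 (P? i ×-dec f i ≟ b))
  fibre i i<n with P? i
  ... | no _   = z≤n
  ... | yes pi = ≤-trans
    (≤-reflexive (sym (𝟙-yes (yes pi ×-dec f i ≟ f i) (pi , refl))))
    (∑-term (λ b → 𝟙 (yes pi ×-dec f i ≟ b)) (f<B i<n pi))

-- Distribution of the multiples of x modulo n

%≡⇒∣∸ : ∀ n .{{_ : NonZero n}} {a b} → a % n ≡ b % n → n ∣ b ∸ a
%≡⇒∣∸ n {a} {b} a≡b = divides (b ℕ./ n ∸ a ℕ./ n) (begin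
  b ∸ a                                                        ≡⟨ cong₂ _∸_ (m≡m%n+[m/n]*n b n) (m≡m%n+[m/n]*n a n) ⟩
  (b % n + b ℕ./ n * n) ∸ (a % n + a ℕ./ n * n)                ≡⟨ cong (λ r → (b % n + b ℕ./ n * n) ∸ (r + a ℕ./ n * n)) a≡b ⟩
  (b % n + b ℕ./ n * n) ∸ (b % n + a ℕ./ n * n)                ≡⟨ [m+n]∸[m+o]≡n∸o (b % n) _ _ ⟩
  b ℕ./ n * n ∸ a ℕ./ n * n                                    ≡⟨ sym (*-distribʳ-∸ n (b ℕ./ n) (a ℕ./ n)) ⟩
  (b ℕ./ n ∸ a ℕ./ n) * n                                      ∎)
  where open ≡-Reasoning

divisor-quotient-nonZero : ∀ {m n k} .{{_ : NonZero n}} → n ≡ k * m → NonZero k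
divisor-quotient-nonZero {n = n} n≡km =
  ℕ.≢-nonZero (λ k≡0 → ℕ.≢-nonZero⁻¹ n (trans n≡km (cong (_* _) k≡0)))

-- With g = gcd x n, each value of d ↦ x d mod n is a multiple of g and is
-- taken once in each of the g blocks of length n / g; d is sent to that value
-- minus the (one-based) number of its block.
residue-count : ∀ n .{{_ : NonZero n}} x B →
  ∑ n (λ d → 𝟙 (1 ≤? (x * d) % n ×-dec (x * d) % n ≤? B)) ≤ B
residue-count n x B with gcd[m,n]∣n x n
... | divides n′ n≡n′g = count-injection n B _ f
  (λ {d} d<n (1≤r , r≤B) → <-≤-trans (∸-monoʳ-< (s≤s z≤n) (block≤ d<n 1≤r)) r≤B)
  f-inj
  where
  g : ℕ
  g = gcd x n
  instance
    n′≢0 : NonZero n′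
    n′≢0 = divisor-quotient-nonZero n≡n′g
    g≢0 : NonZero g
    g≢0 = divisor-quotient-nonZero (trans n≡n′g (*-comm n′ g))
  r block f : ℕ → ℕ
  r d = (x * d) % n
  block d = d ℕ./ n′
  -- The g arguments sharing a value h g are spread over the g integers from (h - 1) g to h g - 1,
  -- so distinct values never collide and all images stay below B.
  f d = r d ∸ suc (block d)
  g∣r : ∀ d → g ∣ r d
  g∣r d = %-presˡ-∣ (∣m⇒∣m*n d (gcd[m,n]∣m x n)) (gcd[m,n]∣n x n)
  block<g : ∀ {d} → d < n → block d < g
  block<g {d} d<n = m<n*o⇒m/o<n (subst (d <_) (trans n≡n′g (*-comm n′ g)) d<n)
  block≤ : ∀ {d} → d < n → 1 ≤ r d → suc (block d) ≤ r d
  block≤ {d} d<n 1≤r = ≤-trans (block<g d<n) (∣⇒≤ {{ℕ.>-nonZero 1≤r}} (g∣r d))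
  same-block : ∀ {d e} → d ≤ e → r d ≡ r e → block d ≡ block e → d ≡ e
  same-block {d} {e} d≤e rd≡re bd≡be = sym (trans e≡d+kn′ (trans (cong (λ k → d + k * n′) k≡0) (+-identityʳ d)))
    where
    n∣xe : n ∣ x * (e ∸ d)
    n∣xe = subst (n ∣_) (sym (*-distribˡ-∸ x e d)) (%≡⇒∣∸ n rd≡re)
    n∣ge : n ∣ (e ∸ d) * g
    n∣ge = subst (n ∣_) (sym (c*gcd[m,n]≡gcd[cm,cn] (e ∸ d) x n))
      (gcd-greatest (subst (n ∣_) (*-comm x (e ∸ d)) n∣xe) (n∣m*n (e ∸ d)))
    n′∣ : n′ ∣ e ∸ d
    n′∣ = *-cancelʳ-∣ g (subst (_∣ (e ∸ d) * g) n≡n′g n∣ge)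
    k : ℕ
    k = _∣_.quotient n′∣
    e≡d+kn′ : e ≡ d + k * n′
    e≡d+kn′ = trans (sym (m+[n∸m]≡n d≤e)) (cong (d ℕ.+_) (_∣_.equality n′∣))
    k≡0 : k ≡ 0
    k≡0 = sym (+-cancelˡ-≡ (block d) 0 k (begin
      block d + 0                 ≡⟨ +-identityʳ _ ⟩
      block d                     ≡⟨ bd≡be ⟩
      e ℕ./ n′                    ≡⟨ cong (ℕ._/ n′) e≡d+kn′ ⟩
      (d + k * n′) ℕ./ n′         ≡⟨ +-distrib-/-∣ʳ d {k * n′} {n′} (n∣m*n k) ⟩
      block d + k * n′ ℕ./ n′     ≡⟨ cong (block d ℕ.+_) (m*n/n≡m k n′) ⟩
      block d + k                 ∎))
      where open ≡-Reasoning
  f-inj : ∀ {d e} → d < n → e < n → _ → _ → f d ≡ f e → d ≡ e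
  f-inj {d} {e} d<n e<n (1≤rd , _) (1≤re , _) fd≡fe = aligned (≤-total d e)
    where
    crossed : r d + suc (block e) ≡ r e + suc (block d)
    crossed = begin
      r d + suc (block e)                          ≡⟨ cong (_+ suc (block e)) (sym (m∸n+n≡m (block≤ d<n 1≤rd))) ⟩
      f d + suc (block d) + suc (block e)          ≡⟨ cong (λ z → z + suc (block d) + suc (block e)) fd≡fe ⟩
      f e + suc (block d) + suc (block e)          ≡⟨ swap (f e) (suc (block d)) (suc (block e)) ⟩
      f e + suc (block e) + suc (block d)          ≡⟨ cong (_+ suc (block d)) (m∸n+n≡m (block≤ e<n 1≤re)) ⟩
      r e + suc (block d)                          ∎
      where
      open ≡-Reasoning
      swap : ∀ a b c → a + b + c ≡ a + c + b
      swap = solve-∀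
    crossed′ : block e + r d ≡ block d + r e
    crossed′ = suc-injective (trans (+-comm (suc (block e)) (r d)) (trans crossed (+-comm (r e) _)))
    mod-g : ∀ b c → b < g → (b + r c) % g ≡ b
    mod-g b c b<g = trans (cong (λ z → (b + z) % g) (_∣_.equality (g∣r c)))
      (trans ([m+kn]%n≡m%n b (_∣_.quotient (g∣r c)) g) (m<n⇒m%n≡m b<g))
    -- Both residues are multiples of g and both block numbers are below g, so `crossed′` modulo g
    -- equates the blocks.
    be≡bd : block e ≡ block d
    be≡bd = trans (sym (mod-g (block e) d (block<g e<n)))
      (trans (cong (_% g) crossed′) (mod-g (block d) e (block<g d<n)))
    rd≡re : r d ≡ r e
    rd≡re = +-cancelˡ-≡ (block d) (r d) (r e) (trans (cong (_+ r d) (sym be≡bd)) crossed′)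
    aligned : _ → d ≡ e
    aligned (inj₁ d≤e) = same-block d≤e rd≡re (sym be≡bd)
    aligned (inj₂ e≤d) = sym (same-block e≤d (sym rd≡re) be≡bd)

-- Truncated quotient sums

suc-pred-2^ : ∀ L → suc (ℕ.pred (2 ^ L)) ≡ 2 ^ L
suc-pred-2^ L = suc-pred (2 ^ L) {{m^n≢0 2 L}}

-- Dyadic blocks: the 2 ^ L terms with 2 ^ L ≤ suc i < 2 ^ suc L add up to at most m.
harmonic-bound : ∀ m {T} L → T < 2 ^ L → ∑ T (λ i → m ℕ./ suc i) ≤ m * L
harmonic-bound m {T} L T<2^L = ≤-trans (∑-monoˡ _ (<⇒≤pred T<2^L)) (blocks L)
  where
  open ≤-Reasoning
  blocks : ∀ L → ∑ (ℕ.pred (2 ^ L)) (λ i → m ℕ./ suc i) ≤ m * L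
  blocks zero    = z≤n
  blocks (suc L) = begin
    ∑ (ℕ.pred (2 ^ suc L)) f                  ≡⟨ cong (λ k → ∑ k f) (suc-injective (trans (suc-pred-2^ (suc L)) split)) ⟩
    ∑ (k + 2 ^ L) f                           ≡⟨ ∑-append k (2 ^ L) f ⟩
    ∑ k f + ∑ (2 ^ L) (λ i → f (k + i))            ≤⟨ +-mono-≤ (blocks L) (∑-mono (2 ^ L) small) ⟩
    m * L + ∑ (2 ^ L) (λ _ → m/2^L)           ≡⟨ cong (m * L ℕ.+_) (trans (∑-const (2 ^ L) m/2^L) (*-comm (2 ^ L) m/2^L)) ⟩
    m * L + m/2^L * 2 ^ L                     ≤⟨ +-monoʳ-≤ (m * L) (m/n*n≤m m (2 ^ L)) ⟩
    m * L + m                                 ≡⟨ trans (+-comm (m * L) m) (sym (*-suc m L)) ⟩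
    m * suc L                                 ∎
    where
    instance
      2^L≢0 : NonZero (2 ^ L)
      2^L≢0 = m^n≢0 2 L
    f : ℕ → ℕ
    f i = m ℕ./ suc i
    k m/2^L : ℕ
    k = ℕ.pred (2 ^ L)
    m/2^L = m ℕ./ 2 ^ L
    split : 2 ^ suc L ≡ suc (k + 2 ^ L)
    split = cong₂ _+_ (sym (suc-pred-2^ L)) (+-identityʳ (2 ^ L))
    small : ∀ i → i < 2 ^ L → f (k + i) ≤ m/2^L
    small i _ = /-monoʳ-≤ m (subst (_≤ suc (k + i)) (suc-pred-2^ L) (s≤s (m≤m+n k i)))

module _ (n T : ℕ) .{{_ : NonZero n}} where

  -- min(T, ⌊n / (x r)⌋), with junk value 0 at r = 0.
  H : ℕ → ℕ → ℕ
  H x r = ∑ T (λ t → 𝟙 (1 ≤? r ×-dec suc t * (x * r) ≤? n))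

  Φ : ℕ → ℕ
  Φ d = ∑ n (λ x → H x ((x * d) % n))

  H[0]≡0 : ∀ x → H x 0 ≡ 0
  H[0]≡0 x = trans (∑-cong T (λ t _ → 𝟙-no (1 ≤? 0 ×-dec suc t * (x * 0) ≤? n) (λ ())))
    (trans (∑-const T 0) (*-zeroʳ T))

  H-lower : ∀ {x r m} → 1 ≤ r → m * (x * r) ≤ n → m ≤ T → m ≤ H x r
  H-lower {x} {r} {m} 1≤r mxr≤n m≤T = begin
    m                                                         ≡⟨ sym (trans (∑-const m 1) (*-identityʳ m)) ⟩
    ∑ m (λ _ → 1)                                             ≡⟨ sym (∑-cong m (λ t t<m → 𝟙-yes (1 ≤? r ×-dec suc t * (x * r) ≤? n)
                                                                   (1≤r , ≤-trans (*-monoˡ-≤ (x * r) t<m) mxr≤n))) ⟩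
    ∑ m (λ t → 𝟙 (1 ≤? r ×-dec suc t * (x * r) ≤? n))         ≤⟨ ∑-monoˡ _ m≤T ⟩
    H x r                                                     ∎
    where open ≤-Reasoning

  -- Level t confines the residue to the range from 1 to ⌊⌊n/x⌋ / (t+1)⌋, and `residue-count` allows
  -- at most that many d. What remains is a harmonic sum of T terms: this is where log T enters.
  ∑H-bound : ∀ {L} → T < 2 ^ L → ∀ x .{{_ : NonZero x}} → ∑ n (λ d → H x ((x * d) % n)) ≤ n ℕ./ x * L
  ∑H-bound {L} T<2^L x = begin
    ∑ n (λ d → H x (r d))                                                   ≡⟨ ∑-swap n T _ ⟩
    ∑ T (λ t → ∑ n (λ d → 𝟙 (1 ≤? r d ×-dec suc t * (x * r d) ≤? n)))       ≤⟨ ∑-mono T (λ t _ → ∑-mono n (λ d _ → weaken t d)) ⟩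
    ∑ T (λ t → ∑ n (λ d → 𝟙 (1 ≤? r d ×-dec r d ≤? n ℕ./ x ℕ./ suc t)))     ≤⟨ ∑-mono T (λ t _ → residue-count n x (n ℕ./ x ℕ./ suc t)) ⟩
    ∑ T (λ t → n ℕ./ x ℕ./ suc t)                                           ≤⟨ harmonic-bound (n ℕ./ x) L T<2^L ⟩
    n ℕ./ x * L                                                             ∎
    where
    open ≤-Reasoning
    r : ℕ → ℕ
    r d = (x * d) % n
    quotient-lower : ∀ {m k o} .{{_ : NonZero k}} → m * k ≤ o → m ≤ o ℕ./ k
    quotient-lower {m} {k} {o} mk≤o = subst (_≤ o ℕ./ k) (m*n/n≡m m k) (/-monoˡ-≤ k mk≤o)
    reorder : ∀ t x r → t * (x * r) ≡ r * t * x
    reorder = solve-∀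
    weaken : ∀ t d → 𝟙 (1 ≤? r d ×-dec suc t * (x * r d) ≤? n) ≤ 𝟙 (1 ≤? r d ×-dec r d ≤? n ℕ./ x ℕ./ suc t)
    weaken t d = 𝟙-mono (1 ≤? r d ×-dec suc t * (x * r d) ≤? n) (1 ≤? r d ×-dec r d ≤? n ℕ./ x ℕ./ suc t) λ where
      (1≤r , h) → 1≤r , quotient-lower (quotient-lower (subst (_≤ n) (reorder (suc t) x (r d)) h))

  ∑Φ-bound : ∀ {L M} → n ≤ 2 ^ L → T < 2 ^ M → ∑ n Φ ≤ n * L * M
  ∑Φ-bound {L} {M} n≤2^L T<2^M = begin
    ∑ n Φ                                                  ≡⟨ ∑-swap n n _ ⟩
    ∑ n column                                             ≡⟨ cong (λ k → ∑ k column) (sym (suc-pred n)) ⟩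
    ∑ (suc (ℕ.pred n)) column                              ≡⟨ ∑-head (ℕ.pred n) column ⟩
    column 0 + ∑ (ℕ.pred n) (column ∘ suc)                 ≡⟨ cong (_+ ∑ (ℕ.pred n) (column ∘ suc)) column[0]≡0 ⟩
    ∑ (ℕ.pred n) (column ∘ suc)                            ≤⟨ ∑-mono (ℕ.pred n) (λ x _ → ∑H-bound T<2^M (suc x)) ⟩
    ∑ (ℕ.pred n) (λ x → n ℕ./ suc x * M)                   ≡⟨ ∑-*ʳ (ℕ.pred n) (λ x → n ℕ./ suc x) M ⟩
    ∑ (ℕ.pred n) (λ x → n ℕ./ suc x) * M                   ≤⟨ *-monoˡ-≤ M (harmonic-bound n L
                                                                (subst (_≤ 2 ^ L) (sym (suc-pred n)) n≤2^L)) ⟩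
    n * L * M                                              ∎
    where
    open ≤-Reasoning
    column : ℕ → ℕ
    column x = ∑ n (λ d → H x ((x * d) % n))
    column[0]≡0 : column 0 ≡ 0
    column[0]≡0 = trans (∑-cong n (λ d _ → trans (cong (H 0) (m<n⇒m%n≡m (ℕ.>-nonZero⁻¹ n))) (H[0]≡0 0)))
      (trans (∑-const n 0) (*-zeroʳ n))

  -- The reflection of d to n - d sends 0 to n, so averaging `Φ` over the reflected residues needs
  -- the two ends to agree.
  Φ[0]≡Φ[n] : Φ 0 ≡ Φ n
  Φ[0]≡Φ[n] = ∑-cong n (λ x _ → cong (H x) (trans
    (trans (cong (_% n) (*-zeroʳ x)) (m<n⇒m%n≡m (ℕ.>-nonZero⁻¹ n))) (sym (m*n%n≡0 x n))))

  -- The state after some steps consists of consecutive remainders a > b and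
  -- continuants X, Y with X a + Y b = n, where X d ≡ b and Y d ≡ - a modulo n;
  -- one step exchanges d and d′, which stands for - d.  The remaining
  -- equations keep all multiples of n explicit and free of subtraction.
  quotient-sum-bound : ∀ (G : ℕ → ℕ) → (∀ {x} → x < n → G x < T) →
    ∀ a b (rec : Acc _<_ b) {d d′ X Y k j l i} →
    (∀ {x} → x < n → H x ((x * d) % n) ≤ G x) → (∀ {x} → x < n → H x ((x * d′) % n) ≤ G x) →
    b < a → 1 ≤ X → 1 ≤ Y → X * a + Y * b ≡ n →
    X * d ≡ b + k * n → X * d′ + b ≡ j * n → Y * d′ ≡ a + l * n → Y * d + a ≡ i * n →
    sum (quotients-acc a b rec) + ∑ X G ≤ ∑ n G
  quotient-sum-bound G G<T a zero rec {X = X} _ _ 0<a _ _ Xa+Yb≡n _ _ _ _ = ∑-monoˡ G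
    (≤-trans (m≤m*n X a {{ℕ.>-nonZero 0<a}}) (m+n≤o⇒m≤o (X * a) (≤-reflexive Xa+Yb≡n)))
  quotient-sum-bound G G<T a b@(suc _) (acc rs) {d} {d′} {X} {Y} {k} {j} {l} {i}
    hd hd′ b<a 1≤X 1≤Y Xa+Yb≡n Xd Xd′ Yd′ Yd = begin
    q + sum (quotients-acc b b′ (rs (m%n<n a b))) + ∑ X G     ≡⟨ rotate q _ (∑ X G) ⟩
    -- The quotient is charged to the slot X of `G`. The next continuant exceeds X, so no slot is
    -- charged twice.
    sum (quotients-acc b b′ (rs (m%n<n a b))) + (∑ X G + q)   ≤⟨ +-monoʳ-≤ (sum (quotients-acc b b′ (rs (m%n<n a b)))) (+-monoʳ-≤ (∑ X G) q≤GX) ⟩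
    sum (quotients-acc b b′ (rs (m%n<n a b))) + ∑ (suc X) G   ≤⟨ +-monoʳ-≤ (sum (quotients-acc b b′ (rs (m%n<n a b)))) (∑-monoˡ G X<X′) ⟩
    sum (quotients-acc b b′ (rs (m%n<n a b))) + ∑ X′ G        ≤⟨ quotient-sum-bound G G<T b b′ (rs (m%n<n a b))
                                                                   {d′} {d} {X′} {X} {q * j + l} {q * k + i} {k} {j}
                                                                   hd′ hd (m%n<n a b) (≤-trans (s≤s z≤n) X<X′) 1≤X
                                                                   X′b+Xb′≡n X′d′ X′d Xd Xd′ ⟩
    ∑ n G                                                     ∎
    where
    open ≤-Reasoning
    q b′ X′ : ℕ
    q  = a ℕ./ b
    b′ = a % b
    X′ = q * X + Y
    rotate : ∀ x y z → x + y + z ≡ y + (z + x)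
    rotate = solve-∀
    a≡ : a ≡ b′ + q * b
    a≡ = m≡m%n+[m/n]*n a b
    Xa≤n : X * a ≤ n
    Xa≤n = m+n≤o⇒m≤o (X * a) (≤-reflexive Xa+Yb≡n)
    a≤n : a ≤ n
    a≤n = ≤-trans (m≤n*m a X {{ℕ.>-nonZero 1≤X}}) Xa≤n
    X<n : X < n
    X<n = <-≤-trans (m<m*n X a {{ℕ.>-nonZero 1≤X}} (≤-trans (s≤s (s≤s z≤n)) b<a)) Xa≤n
    1≤q : 1 ≤ q
    1≤q = m≥n⇒m/n>0 (<⇒≤ b<a)
    X<X′ : X < X′
    X<X′ = ≤-trans (≤-reflexive (+-comm 1 X)) (+-mono-≤ (m≤n*m X q {{ℕ.>-nonZero 1≤q}}) 1≤Y)
    Xd%n≡b : (X * d) % n ≡ b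
    Xd%n≡b = trans (cong (_% n) Xd) (trans ([m+kn]%n≡m%n b k n) (m<n⇒m%n≡m (<-≤-trans b<a a≤n)))
    capped : ∀ {m} → m * (X * b) ≤ n → m ≤ T → m ≤ G X
    capped mXb≤n m≤T = ≤-trans
      (subst (λ r → _ ≤ H X r) (sym Xd%n≡b) (H-lower {X} (s≤s z≤n) mXb≤n m≤T)) (hd X<n)
    qXb≤n : q * (X * b) ≤ n
    qXb≤n = ≤-trans (≤-reflexive (reorder q X b))
      (≤-trans (*-monoʳ-≤ X (≤-trans (m≤n+m (q * b) b′) (≤-reflexive (sym a≡)))) Xa≤n)
      where
      reorder : ∀ q x b → q * (x * b) ≡ x * (q * b)
      reorder = solve-∀
    q≤GX : q ≤ G X
    q≤GX with q ≤? T
    ... | yes q≤T = capped qXb≤n q≤T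
    -- A quotient above T would fill all T levels and push `G X` up to T.
    ... | no  q≰T = contradiction (capped (≤-trans (*-monoˡ-≤ (X * b) (<⇒≤ (≰⇒> q≰T))) qXb≤n) ≤-refl) (<⇒≱ (G<T X<n))
    X′b+Xb′≡n : X′ * b + X * b′ ≡ n
    X′b+Xb′≡n = trans (identity q X Y b b′) (trans (cong (λ z → X * z + Y * b) (sym a≡)) Xa+Yb≡n)
      where
      identity : ∀ q x y b c → (q * x + y) * b + x * c ≡ x * (c + q * b) + y * b
      identity = solve-∀
    X′d′ : X′ * d′ ≡ b′ + (q * j + l) * n
    X′d′ = +-cancelʳ-≡ (q * b) _ _ (trans (expand q X Y d′ b)
      (trans (cong₂ (λ u v → q * u + v) Xd′ Yd′)
      (trans (cong (λ z → q * (j * n) + (z + l * n)) a≡) (collect q j l n b b′))))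
      where
      expand : ∀ q x y d b → (q * x + y) * d + q * b ≡ q * (x * d + b) + y * d
      expand = solve-∀
      collect : ∀ q j l n b c → q * (j * n) + (c + q * b + l * n) ≡ c + (q * j + l) * n + q * b
      collect = solve-∀
    X′d : X′ * d + b′ ≡ (q * k + i) * n
    X′d = trans (expand q X Y d b′) (trans (cong (λ z → q * z + Y * d + b′) Xd)
      (trans (regroup q b k n (Y * d) b′) (trans (cong (λ z → q * (k * n) + (Y * d + z)) (sym a≡))
      (trans (cong (q * (k * n) ℕ.+_) Yd) (collect q k i n)))))
      where
      expand : ∀ q x y d c → (q * x + y) * d + c ≡ q * (x * d) + y * d + c
      expand = solve-∀
      regroup : ∀ q b k n y c → q * (b + k * n) + y + c ≡ q * (k * n) + (y + (c + q * b))
      regroup = solve-∀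
      collect : ∀ q k i n → q * (k * n) + i * n ≡ (q * k + i) * n
      collect = solve-∀

  -- The first step is split off because the continuants start with 1 and q, which coincide when q =
  -- 1; strict growth is only guaranteed afterwards. The first quotient is charged to slot 1 of a
  -- second copy of the sum, hence the factor 2.
  quotients-acc-bound : ∀ d (rec : Acc _<_ d) → 1 ≤ d → d < n → Φ d + Φ (n ∸ d) < T →
    sum (quotients-acc n d rec) ≤ 2 * (Φ d + Φ (n ∸ d))
  quotients-acc-bound d@(suc _) (acc rs) 1≤d d<n S<T = begin
    q + sum (quotients-acc d r (rs (m%n<n n d)))     ≤⟨ +-mono-≤ q≤S (m+n≤o⇒m≤o _ rest) ⟩
    ∑ n G + ∑ n G                                    ≡⟨ cong (∑ n G ℕ.+_) (sym (+-identityʳ (∑ n G))) ⟩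
    2 * ∑ n G                                        ≡⟨ cong (2 *_) ∑G≡S ⟩
    2 * (Φ d + Φ d′)                                 ∎
    where
    open ≤-Reasoning
    q r d′ : ℕ
    q  = n ℕ./ d
    r  = n % d
    d′ = n ∸ d
    G : ℕ → ℕ
    G x = H x ((x * d) % n) + H x ((x * d′) % n)
    ∑G≡S : ∑ n G ≡ Φ d + Φ d′
    ∑G≡S = ∑-+ n (λ x → H x ((x * d) % n)) (λ x → H x ((x * d′) % n))
    ∑G<T : ∑ n G < T
    ∑G<T = subst (_< T) (sym ∑G≡S) S<T
    G<T : ∀ {x} → x < n → G x < T
    G<T x<n = ≤-<-trans (∑-term G x<n) ∑G<T
    1<n : 1 < n
    1<n = ≤-<-trans 1≤d d<n
    d+d′≡n : d + d′ ≡ n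
    d+d′≡n = m+[n∸m]≡n (<⇒≤ d<n)
    n≡ : n ≡ r + q * d
    n≡ = m≡m%n+[m/n]*n n d
    capped : ∀ {m} → m * (1 * d) ≤ n → m ≤ T → m ≤ G 1
    capped {m} md≤n m≤T = ≤-trans
      (subst (λ r → m ≤ H 1 r) (sym (trans (cong (_% n) (*-identityˡ d)) (m<n⇒m%n≡m d<n))) (H-lower {1} 1≤d md≤n m≤T))
      (m≤m+n (H 1 ((1 * d) % n)) (H 1 ((1 * d′) % n)))
    qd≤n : q * (1 * d) ≤ n
    qd≤n = subst (λ z → q * z ≤ n) (sym (*-identityˡ d)) (m/n*n≤m n d)
    q≤S : q ≤ ∑ n G
    q≤S with q ≤? T
    ... | yes q≤T = ≤-trans (capped qd≤n q≤T) (∑-term G 1<n)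
    ... | no  q≰T = contradiction (capped (≤-trans (*-monoˡ-≤ (1 * d) (<⇒≤ (≰⇒> q≰T))) qd≤n) ≤-refl) (<⇒≱ (G<T 1<n))
    1≤q : 1 ≤ q
    1≤q = m≥n⇒m/n>0 (<⇒≤ d<n)
    -- Here q d + q d′ = q n and q d = n - r.
    qd′ : q * d′ ≡ r + ℕ.pred q * n
    qd′ = +-cancelʳ-≡ (q * d) _ _ (trans (sym (*-distribˡ-+ q d′ d))
      (trans (cong (q *_) (trans (+-comm d′ d) d+d′≡n))
      (trans (cong (_* n) (sym (suc-pred q {{ℕ.>-nonZero 1≤q}})))
      (trans (cong (_+ ℕ.pred q * n) n≡) (swap r (q * d) (ℕ.pred q * n))))))
      where
      swap : ∀ x y z → x + y + z ≡ x + z + y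
      swap = solve-∀
    rest : sum (quotients-acc d r (rs (m%n<n n d))) + ∑ q G ≤ ∑ n G
    -- The pair is now (d, r) with continuants q and 1. Since q d ≡ - r modulo n, the residue d′
    -- takes the part of d.
    rest = quotient-sum-bound G G<T d r (rs (m%n<n n d)) {d′} {d} {q} {1} {ℕ.pred q} {1} {0} {1}
      (λ _ → m≤n+m _ _) (λ _ → m≤m+n _ _) (m%n<n n d) 1≤q ≤-refl
      (trans (cong (q * d ℕ.+_) (*-identityˡ r)) (trans (+-comm (q * d) r) (sym n≡)))
      qd′
      (trans (+-comm (q * d) r) (trans (sym n≡) (sym (*-identityˡ n))))
      (trans (*-identityˡ d) (sym (+-identityʳ d)))
      (trans (cong (_+ d) (*-identityˡ d′)) (trans (+-comm d′ d) (trans d+d′≡n (sym (*-identityˡ n)))))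

  s-bound : ∀ {d} → 1 ≤ d → d < n → Φ d + Φ (n ∸ d) < T → s n d ≤ 2 * (Φ d + Φ (n ∸ d))
  s-bound {d} = quotients-acc-bound d (<-wellFounded d)

-- Totients

-- `upTo` is `applyUpTo id`, whose tail composes the function with `suc`; the induction therefore
-- carries an arbitrary f.
length-filter-applyUpTo : ∀ {P : ℕ → Set} (P? : ∀ i → Dec (P i)) (g f : ℕ → ℕ) n →
  length (filter P? (map g (applyUpTo f n))) ≡ ∑ n (λ i → 𝟙 (P? (g (f i))))
length-filter-applyUpTo P? g f zero    = refl
length-filter-applyUpTo P? g f (suc n) = trans (first (P? (g (f 0)))) (sym (∑-head n (λ i → 𝟙 (P? (g (f i))))))
  where
  first : ∀ d → length (filter P? (map g (applyUpTo f (suc n)))) ≡ 𝟙 (P? (g (f 0))) + ∑ n (λ i → 𝟙 (P? (g (f (suc i)))))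
  first _ with P? (g (f 0))
  ... | yes _ = cong suc (length-filter-applyUpTo P? g (f ∘ suc) n)
  ... | no  _ = length-filter-applyUpTo P? g (f ∘ suc) n

coprime-shift : ∀ {i n} k → Coprime i n → Coprime (k * n + i) n
coprime-shift k i⊥n (d∣kn+i , d∣n) = i⊥n (∣m+n∣m⇒∣n d∣kn+i (∣n⇒∣m*n k d∣n) , d∣n)

coprime-unshift : ∀ {i n} k → Coprime (k * n + i) n → Coprime i n
coprime-unshift k kn+i⊥n (d∣i , d∣n) = kn+i⊥n (∣m∣n⇒∣m+n (∣n⇒∣m*n k d∣n) d∣i , d∣n)

coprime-*ʳ : ∀ {i m p} → Coprime i p → Coprime i m → Coprime i (p * m)
coprime-*ʳ i⊥p i⊥m (d∣i , d∣pm) = i⊥m (d∣i ,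
  coprime-divisor (λ (e∣d , e∣p) → i⊥p (∣-trans e∣d d∣i , e∣p)) d∣pm)

coprime-∣ʳ : ∀ {i m p} → p ∣ m → Coprime i m → Coprime i p
coprime-∣ʳ p∣m i⊥m (d∣i , d∣p) = i⊥m (d∣i , ∣-trans d∣p p∣m)

κ : ℕ → ℕ → ℕ
κ n i = 𝟙 (coprime? i n)

κ-periodic : ∀ n k i → κ n (k * n + i) ≡ κ n i
κ-periodic n k i = 𝟙-cong (coprime? (k * n + i) n) (coprime? i n) (coprime-unshift k) (coprime-shift k)

-- `φ` counts among 1, ..., n, the sums here run over 0, ..., n - 1; the differing ends are
-- congruent modulo n.
φ≡∑κ : ∀ n → φ n ≡ ∑ n (κ n)
φ≡∑κ n = trans (length-filter-applyUpTo (λ k → coprime? k n) suc id n)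
  (∑-shift n (κ n) (sym (trans (cong (κ n) (sym (trans (+-identityʳ (n + 0)) (+-identityʳ n)))) (κ-periodic n 1 0))))

φ≤n : ∀ n → φ n ≤ n
φ≤n n = ≤-trans (≤-reflexive (φ≡∑κ n)) (≤-trans
  (∑-mono n (λ i _ → 𝟙≤1 (coprime? i n))) (≤-reflexive (trans (∑-const n 1) (*-identityʳ n))))
  where
  𝟙≤1 : ∀ {P : Set} (P? : Dec P) → 𝟙 P? ≤ 1
  𝟙≤1 (yes _) = s≤s z≤n
  𝟙≤1 (no _)  = z≤n

∑κ-periods : ∀ p m → ∑ (p * m) (κ m) ≡ p * φ m
∑κ-periods p m = trans (∑-blocks p m (κ m))
  (trans (∑-cong p (λ j _ → trans (∑-cong m (λ i _ → κ-periodic m j i)) (sym (φ≡∑κ m)))) (∑-const p (φ m)))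

-- If p divides m, being coprime to m already means being coprime to p m, so all p periods of length
-- m survive intact.
φ-*-∣ : ∀ {p m} → p ∣ m → p * φ m ≤ φ (p * m)
φ-*-∣ {p} {m} p∣m = begin
  p * φ m                    ≡⟨ sym (∑κ-periods p m) ⟩
  ∑ (p * m) (κ m)            ≤⟨ ∑-mono (p * m) (λ i _ → 𝟙-mono (coprime? i m) (coprime? i (p * m))
                                  (λ i⊥m → coprime-*ʳ (coprime-∣ʳ p∣m i⊥m) i⊥m)) ⟩
  ∑ (p * m) (κ (p * m))      ≡⟨ sym (φ≡∑κ (p * m)) ⟩
  φ (p * m)                  ∎
  where open ≤-Reasoning

prime∤⇒coprime : ∀ {p i} → Prime p → p ∤ i → Coprime i p
prime∤⇒coprime pr p∤i (d∣i , d∣p) with prime⇒irreducible pr d∣p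
... | inj₁ d≡1 = d≡1
... | inj₂ refl = contradiction d∣i p∤i

-- Among the p φ(m) numbers below p m that are coprime to m, the non-multiples of p are coprime to p
-- m. A multiple j p has j < m coprime to m, which leaves at most φ(m) of them.
φ-*-prime : ∀ {p} m → Prime p → p * φ m ≤ φ (p * m) + φ m
φ-*-prime {zero}      m _  = z≤n
φ-*-prime {p@(suc p′)} m pr = begin
  p * φ m                                       ≡⟨ sym (∑κ-periods p m) ⟩
  ∑ (p * m) (κ m)                               ≤⟨ ∑-mono (p * m) (λ i _ → split i) ⟩
  ∑ (p * m) (λ i → κ (p * m) i + multiple i)    ≡⟨ ∑-+ (p * m) (κ (p * m)) multiple ⟩
  ∑ (p * m) (κ (p * m)) + ∑ (p * m) multiple    ≤⟨ +-mono-≤ (≤-reflexive (sym (φ≡∑κ (p * m)))) multiples ⟩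
  φ (p * m) + φ m                               ∎
  where
  open ≤-Reasoning
  multiple : ℕ → ℕ
  multiple i = 𝟙 (p ∣? i ×-dec coprime? i m)
  split : ∀ i → κ m i ≤ κ (p * m) i + multiple i
  split i with p ∣? i
  ... | yes p∣i = ≤-trans (𝟙-mono (coprime? i m) (yes p∣i ×-dec coprime? i m) (p∣i ,_)) (m≤n+m _ _)
  ... | no  p∤i = ≤-trans (𝟙-mono (coprime? i m) (coprime? i (p * m)) (coprime-*ʳ (prime∤⇒coprime pr p∤i))) (m≤m+n _ _)
  block : ∀ j → ∑ p (λ r → multiple (j * p + r)) ≤ κ m j
  block j = begin
    ∑ p (λ r → multiple (j * p + r))                                    ≡⟨ ∑-head p′ (λ r → multiple (j * p + r)) ⟩
    multiple (j * p + 0) + ∑ p′ (λ r → multiple (j * p + suc r))        ≡⟨ cong (multiple (j * p + 0) ℕ.+_)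
      (trans (∑-cong p′ (λ r r<p′ → 𝟙-no (p ∣? (j * p + suc r) ×-dec coprime? (j * p + suc r) m)
        (λ (p∣ , _) → >⇒∤ (s≤s r<p′) (∣m+n∣m⇒∣n p∣ (n∣m*n j))))) (trans (∑-const p′ 0) (*-zeroʳ p′))) ⟩
    multiple (j * p + 0) + 0                                            ≡⟨ +-identityʳ _ ⟩
    multiple (j * p + 0)                                                ≤⟨ 𝟙-mono (p ∣? (j * p + 0) ×-dec coprime? (j * p + 0) m) (coprime? j m)
      (λ (_ , jp⊥m) {d} (d∣j , d∣m) → jp⊥m (subst (d ∣_) (sym (+-identityʳ (j * p))) (∣m⇒∣m*n p d∣j) , d∣m)) ⟩
    κ m j                                                               ∎
  multiples : ∑ (p * m) multiple ≤ φ m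
  multiples = begin
    ∑ (p * m) multiple                               ≡⟨ cong (λ k → ∑ k multiple) (*-comm p m) ⟩
    ∑ (m * p) multiple                               ≡⟨ ∑-blocks m p multiple ⟩
    ∑ m (λ j → ∑ p (λ r → multiple (j * p + r)))     ≤⟨ ∑-mono m (λ j _ → block j) ⟩
    ∑ m (κ m)                                        ≡⟨ sym (φ≡∑κ m) ⟩
    φ m                                              ∎

-- Lower bound for φ(n)/n

primes≤1⇒≡1 : ∀ n .{{_ : NonZero n}} → (∀ {p} → Prime p → p ∣ n → p ≤ 1) → n ≡ 1
primes≤1⇒≡1 n h with factorise n
... | record { factors = []    ; isFactorisation = n≡1 }  = n≡1
... | record { factors = p ∷ ps ; isFactorisation = n≡p*q ; factorsPrime = pr ∷ _ } =
  contradiction (h pr (divides (product ps) (trans n≡p*q (*-comm p (product ps))))) (<⇒≱ (ℕ.nonTrivial⇒n>1 p {{prime⇒nonTrivial pr}}))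

-- w counts the distinct prime factors of n.  Since the i-th smallest of them is
-- at least i + 1, the product of all the 1 - 1/p is at least
-- (1/2) (2/3) ⋯ (w/(w+1)) = 1/(w+1).
φ-Lower : ℕ → ℕ → Set
φ-Lower j n = ∃[ w ] n ≤ φ n * suc w × 2 ^ w ≤ n × w ≤ j

Smooth : ℕ → ℕ → Set
Smooth j n = ∀ {p} → Prime p → p ∣ n → p ≤ suc j

-- The inner recursion strips the powers of q = 2 + j. As long as q divides the cofactor, w stays
-- the same; removing the last copy hands over to the smaller smoothness bound and raises w by one.
φ-lower-suc : ∀ j → (∀ n → 1 ≤ n → Smooth j n → φ-Lower j n) →
  ∀ n → Acc _<_ n → 1 ≤ n → Smooth (suc j) n → φ-Lower (suc j) n
φ-lower-suc j ih n (acc rs) 1≤n smooth with prime? (2 + j) ×-dec (2 + j) ∣? n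
... | no ¬q =
  let w , n≤ , 2^w≤n , w≤j = ih n 1≤n
        (λ pr p∣n → ≤-pred (≤∧≢⇒< (smooth pr p∣n) (λ { refl → ¬q (pr , p∣n) })))
  in w , n≤ , 2^w≤n , m≤n⇒m≤1+n w≤j
... | yes (pr , divides m n≡mq) = subst (φ-Lower (suc j)) (sym n≡qm) (step (q ∣? m))
  where
  open ≤-Reasoning
  q : ℕ
  q = 2 + j
  n≡qm : n ≡ q * m
  n≡qm = trans n≡mq (*-comm m q)
  1≤m : 1 ≤ m
  1≤m = n≢0⇒n>0 (λ m≡0 → <⇒≢ 1≤n (sym (trans n≡mq (cong (_* q) m≡0))))
  m<qm : m < q * m
  m<qm = subst (m <_) (*-comm m q) (m<m*n m q {{ℕ.>-nonZero 1≤m}} (s≤s (s≤s z≤n)))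
  m<n : m < n
  m<n = subst (m <_) (sym n≡qm) m<qm
  smooth-m : Smooth (suc j) m
  smooth-m pr p∣m = smooth pr (subst (_ ∣_) (sym n≡qm) (∣n⇒∣m*n q p∣m))
  step : Dec (q ∣ m) → φ-Lower (suc j) (q * m)
  step (yes q∣m) =
    let w , m≤ , 2^w≤m , w≤ = φ-lower-suc j ih m (rs m<n) 1≤m smooth-m
    in w , (begin
      q * m                     ≤⟨ *-monoʳ-≤ q m≤ ⟩
      q * (φ m * suc w)         ≡⟨ sym (*-assoc q (φ m) (suc w)) ⟩
      q * φ m * suc w           ≤⟨ *-monoˡ-≤ (suc w) (φ-*-∣ q∣m) ⟩
      φ (q * m) * suc w         ∎) , ≤-trans 2^w≤m (<⇒≤ m<qm) , w≤
  step (no q∤m) =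
    let w , m≤ , 2^w≤m , w≤j = ih m 1≤m
          (λ pr p∣m → ≤-pred (≤∧≢⇒< (smooth-m pr p∣m) (λ { refl → q∤m p∣m })))
    in suc w , (begin
      q * m                             ≤⟨ *-monoʳ-≤ q m≤ ⟩
      q * (φ m * suc w)                 ≡⟨ expand j w (φ m) ⟩
      -- This is 1 - 1/q ≥ (w+1)/(w+2), which holds because w ≤ j means w + 2 ≤ q.
      suc j * φ m * suc w + φ m * suc w ≤⟨ +-monoʳ-≤ (suc j * φ m * suc w) (≤-trans (*-monoʳ-≤ (φ m) (s≤s w≤j)) (≤-reflexive (*-comm (φ m) (suc j)))) ⟩
      suc j * φ m * suc w + suc j * φ m ≡⟨ trans (+-comm _ (suc j * φ m)) (sym (*-suc (suc j * φ m) (suc w))) ⟩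
      suc j * φ m * (2 + w)             ≤⟨ *-monoˡ-≤ (2 + w) drop ⟩
      φ (q * m) * (2 + w)               ∎) ,
      ≤-trans (*-mono-≤ {2} {q} (s≤s (s≤s z≤n)) 2^w≤m) ≤-refl , s≤s w≤j
    where
    expand : ∀ j w f → (2 + j) * (f * suc w) ≡ suc j * f * suc w + f * suc w
    expand = solve-∀
    drop : suc j * φ m ≤ φ (q * m)
    drop = +-cancelˡ-≤ (φ m) _ _ (≤-trans (φ-*-prime m pr) (≤-reflexive (+-comm (φ (q * m)) (φ m))))

φ-lower-smooth : ∀ j n → 1 ≤ n → Smooth j n → φ-Lower j n
φ-lower-smooth zero    n 1≤n smooth with primes≤1⇒≡1 n {{ℕ.>-nonZero 1≤n}} smooth
... | refl = 0 , ≤-refl , ≤-refl , z≤n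
φ-lower-smooth (suc j) n = φ-lower-suc j (φ-lower-smooth j) n (<-wellFounded n)

-- Since 2^w ≤ n, this says that n/φ(n) is at most 1 + log₂ n.
φ-lower : ∀ n → 1 ≤ n → ∃[ w ] n ≤ φ n * suc w × 2 ^ w ≤ n
φ-lower n 1≤n =
  let w , n≤ , 2^w≤n , _ = φ-lower-smooth n n 1≤n
        (λ _ p∣n → m≤n⇒m≤1+n (∣⇒≤ {{ℕ.>-nonZero 1≤n}} p∣n))
  in w , n≤ , 2^w≤n

-- Averaging over the coprime residues

dyadic : ∀ n → 1 ≤ n → ∃[ m ] 2 ^ m ≤ n × n < 2 ^ suc m
dyadic (suc zero)      _ = 0 , ≤-refl , ≤-refl
dyadic (suc n@(suc _)) _ with dyadic n (s≤s z≤n)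
... | m , 2^m≤n , n<2^m+1 with suc n ℕ.<? 2 ^ suc m
...   | yes n+1<2^m+1 = m , m≤n⇒m≤1+n 2^m≤n , n+1<2^m+1
...   | no  n+1≮2^m+1 = suc m , ≮⇒≥ n+1≮2^m+1 ,
  ≤-<-trans n<2^m+1 (^-monoʳ-< 2 (s≤s (s≤s z≤n)) {suc m} {suc (suc m)} ≤-refl)

2^-cancel-≤ : ∀ {m n} → 2 ^ m < 2 ^ suc n → m ≤ n
2^-cancel-≤ {m} {n} h with m ≤? n
... | yes m≤n = m≤n
... | no  m≰n = contradiction h (≤⇒≯ (^-monoʳ-≤ 2 (≰⇒> m≰n)))

n<2^n : ∀ n → n < 2 ^ n
n<2^n zero    = s≤s z≤n
n<2^n (suc n) = ≤-trans (+-mono-≤ (m^n>0 2 n) (n<2^n n)) (≤-reflexive (cong (2 ^ n ℕ.+_) (sym (+-identityʳ _))))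

-- The average over coprime d is bounded by the sum over all d, divided by φ(n). Weighting both
-- sides with `κ` ensures that a strict inequality between terms can only occur at a coprime d.
coprime-Φ<T : ∀ n T .{{_ : NonZero n}} {L M} → n ≤ 2 ^ L → T < 2 ^ M → 2 * (n * L * M) < φ n * T →
  ∃[ d ] d < n × Coprime d n × Φ n T d + Φ n T (n ∸ d) < T
coprime-Φ<T n T {L} {M} n≤2^L T<2^M small = extract (∑-exists-< n (λ d → κ n d * S d) (λ d → κ n d * T) (begin-strict
  ∑ n (λ d → κ n d * S d)                                ≤⟨ ∑-mono n (λ d _ → κ*≤ d (S d)) ⟩
  ∑ n S                                                  ≡⟨ ∑-+ n (Φ n T) (λ d → Φ n T (n ∸ d)) ⟩
  ∑ n (Φ n T) + ∑ n (λ d → Φ n T (n ∸ d))                ≡⟨ cong (∑ n (Φ n T) ℕ.+_) (trans (∑-reverse n (Φ n T)) (∑-shift n (Φ n T) (Φ[0]≡Φ[n] n T))) ⟩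
  ∑ n (Φ n T) + ∑ n (Φ n T)                              ≤⟨ +-mono-≤ (∑Φ-bound n T n≤2^L T<2^M) (∑Φ-bound n T n≤2^L T<2^M) ⟩
  n * L * M + n * L * M                                  ≡⟨ cong (n * L * M ℕ.+_) (sym (+-identityʳ _)) ⟩
  2 * (n * L * M)                                        <⟨ small ⟩
  φ n * T                                                ≡⟨ cong (_* T) (φ≡∑κ n) ⟩
  ∑ n (κ n) * T                                          ≡⟨ sym (∑-*ʳ n (κ n) T) ⟩
  ∑ n (λ d → κ n d * T)                                  ∎))
  where
  open ≤-Reasoning
  S : ℕ → ℕ
  S d = Φ n T d + Φ n T (n ∸ d)
  κ*≤ : ∀ d m → κ n d * m ≤ m
  κ*≤ d m with coprime? d n
  ... | yes _ = ≤-reflexive (+-identityʳ m)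
  ... | no  _ = z≤n
  extract : ∃[ d ] d < n × κ n d * S d < κ n d * T → ∃[ d ] d < n × Coprime d n × S d < T
  extract (d , d<n , h) with coprime? d n
  ... | yes d⊥n = d , d<n , d⊥n , subst₂ _<_ (+-identityʳ (S d)) (+-identityʳ T) h

-- This breaks the circle between T and log T: n/φ(n) ≤ L gives T ≤ 1 + 2 L² K with K = 8 l, and T <
-- 2^K is required. With P = 2^l the left side is at most 17 P³, and P ≥ 2 makes P^8 at least 32 P³.
threshold-bound : ∀ {L l} → 1 ≤ l → L < 2 ^ l → suc (2 * (L * L * (8 * l))) < 2 ^ (8 * l)
threshold-bound {L} {l} 1≤l L<2^l = begin-strict
  suc (2 * (L * L * (8 * l)))      ≤⟨ s≤s (*-monoʳ-≤ 2 (*-mono-≤ (*-mono-≤ (<⇒≤ L<2^l) (<⇒≤ L<2^l)) (*-monoʳ-≤ 8 (<⇒≤ (n<2^n l))))) ⟩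
  suc (2 * (P * P * (8 * P)))      ≡⟨ cong suc (normalise P) ⟩
  suc (16 * P³)                    ≤⟨ +-monoˡ-≤ (16 * P³) 1≤P³ ⟩
  17 * P³                          <⟨ *-monoˡ-< P³ {{ℕ.>-nonZero 1≤P³}} {17} {32} (m≤m+n 18 14) ⟩
  2 ^ 5 * P³                       ≤⟨ *-monoˡ-≤ P³ (^-monoˡ-≤ 5 2≤P) ⟩
  P ^ 5 * P³                       ≡⟨ collect P ⟩
  P ^ 8                            ≡⟨ ^-*-assoc 2 l 8 ⟩
  2 ^ (l * 8)                      ≡⟨ cong (2 ^_) (*-comm l 8) ⟩
  2 ^ (8 * l)                      ∎
  where
  open ≤-Reasoning
  P P³ : ℕ
  P  = 2 ^ l
  P³ = P * P * P
  2≤P : 2 ≤ P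
  2≤P = ^-monoʳ-≤ 2 {1} 1≤l
  1≤P³ : 1 ≤ P³
  1≤P³ = *-mono-≤ {1} {P * P} {1} {P} (*-mono-≤ {1} {P} {1} {P} (m^n>0 2 l) (m^n>0 2 l)) (m^n>0 2 l)
  normalise : ∀ P → 2 * (P * P * (8 * P)) ≡ 16 * (P * P * P)
  normalise = solve-∀
  collect : ∀ P → P ^ 5 * (P * P * P) ≡ P ^ 8
  collect P = identity P
    where
    identity : ∀ P → (P * (P * (P * (P * (P * 1))))) * (P * P * P) ≡ P * (P * (P * (P * (P * (P * (P * (P * 1)))))))
    identity = solve-∀

small-quotient-sum : ∀ n → 3 ≤ n → ∀ {m l} → 2 ^ m ≤ n → n < 2 ^ suc m → 1 ≤ l → suc m < 2 ^ l →
  ∃[ d ] 1 ≤ d × d ≤ n ∸ 1 × gcd n d ≡ 1 × s n d * φ n ≤ 48 * (n * suc m * l)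
small-quotient-sum n@(suc n-1) 3≤n {m} {l} 2^m≤n n<2^L 1≤l L<2^l =
  let w , n≤φw , 2^w≤n      = φ-lower n 1≤n
      d , d<n , d⊥n , S<T   = coprime-Φ<T n T {L} {K} (<⇒≤ n<2^L) (T<2^K w n≤φw 2^w≤n) A<φT
      1≤d                   = n≢0⇒n>0 {d} (λ d≡0 →
                                <⇒≢ (≤-trans (s≤s (s≤s z≤n)) 3≤n) (sym (0-coprimeTo-m⇒m≡1 (subst (λ d → Coprime d n) d≡0 d⊥n))))
  in d , 1≤d , ≤-pred d<n , coprime⇒gcd≡1 (Coprimality.sym d⊥n) , (begin
    s n d * φ n                       ≤⟨ *-monoˡ-≤ (φ n) (s-bound n T 1≤d d<n S<T) ⟩
    2 * (Φ n T d + Φ n T (n ∸ d)) * φ n ≤⟨ *-monoˡ-≤ (φ n) (*-monoʳ-≤ 2 (<⇒≤ S<T)) ⟩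
    2 * T * φ n                       ≡⟨ *-assoc 2 T (φ n) ⟩
    -- T φ(n) ≤ φ(n) + A ≤ 3 n L K; with the factor 2 of `s-bound` and K = 8 l this becomes 48 n L
    -- l.
    2 * (φ n + A ℕ./ φ n * φ n)       ≤⟨ *-monoʳ-≤ 2 (+-mono-≤ φ≤nLK (m/n*n≤m A (φ n))) ⟩
    2 * (n * L * K + A)               ≡⟨ collect n L l ⟩
    48 * (n * L * l)                  ∎)
  where
  open ≤-Reasoning
  L K A T : ℕ
  L = suc m
  K = 8 * l
  A = 2 * (n * L * K)
  1≤n : 1 ≤ n
  1≤n = s≤s z≤n
  instance
    φ≢0 : NonZero (φ n)
    φ≢0 = φ-nonZero 1≤n
  -- The least T with A < φ(n) T, as the averaging demands.
  T = suc (A ℕ./ φ n)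
  1≤K : 1 ≤ K
  1≤K = ≤-trans 1≤l (m≤n*m l 8)
  φ≤nLK : φ n ≤ n * L * K
  φ≤nLK = ≤-trans (φ≤n n) (≤-trans (m≤m*n n L) (m≤m*n (n * L) K {{ℕ.>-nonZero 1≤K}}))
  A<φT : A < φ n * T
  A<φT = begin-strict
    A                                  ≡⟨ m≡m%n+[m/n]*n A (φ n) ⟩
    A % φ n + A ℕ./ φ n * φ n          <⟨ +-monoˡ-< (A ℕ./ φ n * φ n) (m%n<n A (φ n)) ⟩
    T * φ n                            ≡⟨ *-comm T (φ n) ⟩
    φ n * T                            ∎
  T<2^K : ∀ w → n ≤ φ n * suc w → 2 ^ w ≤ n → T < 2 ^ K
  T<2^K w n≤φw 2^w≤n = ≤-<-trans (s≤s A/φ≤) (threshold-bound {L} 1≤l L<2^l)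
    where
    n≤φL : n ≤ φ n * L
    n≤φL = ≤-trans n≤φw (*-monoʳ-≤ (φ n) (s≤s (2^-cancel-≤ {w} {m} (≤-<-trans 2^w≤n n<2^L))))
    A≤ : A ≤ 2 * (L * L * K) * φ n
    A≤ = ≤-trans (*-monoʳ-≤ 2 (*-monoˡ-≤ K (*-monoˡ-≤ L n≤φL))) (≤-reflexive (reorder (φ n) L K))
      where
      reorder : ∀ f L K → 2 * (f * L * L * K) ≡ 2 * (L * L * K) * f
      reorder = solve-∀
    A/φ≤ : A ℕ./ φ n ≤ 2 * (L * L * K)
    A/φ≤ = subst (A ℕ./ φ n ≤_) (m*n/n≡m (2 * (L * L * K)) (φ n)) (/-monoˡ-≤ (φ n) A≤)
  collect : ∀ n L l → 2 * (n * L * (8 * l) + 2 * (n * L * (8 * l))) ≡ 48 * (n * L * l)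
  collect = solve-∀

-- Logarithms

infix 8 _/1
_/1 : ℕ → ℚ
n /1 = + n / 1

/1-+ : ∀ m n → (m + n) /1 ≡ m /1 ℚ.+ n /1
/1-+ zero    n = sym (ℚₚ.+-identityˡ (n /1))
/1-+ (suc m) n = trans (/1-suc (m + n)) (trans (cong (ℚ._+ 1ℚ) (/1-+ m n))
  (trans (solve 2 (λ a b → a :+ b :+ con 1ℚ := a :+ con 1ℚ :+ b) refl (m /1) (n /1))
  (cong (ℚ._+ n /1) (sym (/1-suc m)))))

/1-* : ∀ m n → (m * n) /1 ≡ m /1 ℚ.* n /1
/1-* zero    n = sym (ℚₚ.*-zeroˡ (n /1))
/1-* (suc m) n = trans (/1-+ n (m * n)) (trans (cong (n /1 ℚ.+_) (/1-* m n))
  (trans (solve 2 (λ a b → b :+ a :* b := (a :+ con 1ℚ) :* b) refl (m /1) (n /1))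
  (cong (ℚ._* n /1) (sym (/1-suc m)))))

0≤/1 : ∀ n → 0ℚ ℚ.≤ n /1
0≤/1 n = /1-mono {0} {n} z≤n

/-*-cancel : ∀ n d .{{_ : NonZero d}} → (+ n / d) ℚ.* d /1 ≡ n /1
/-*-cancel n d@(suc d-1) = ℚₚ.toℚᵘ-injective (ℚᵘₚ.≃-trans (ℚₚ.toℚᵘ-homo-* (+ n / d) (d /1))
  (ℚᵘₚ.≃-trans (ℚᵘₚ.*-cong (ℚₚ.toℚᵘ-fromℚᵘ (ℚᵘ.mkℚᵘ (+ n) d-1)) (toℚᵘ-/1 d))
  (ℚᵘₚ.≃-trans (ℚᵘ.*≡* (trans (ℤₚ.*-assoc (+ n) (+ d) (+ 1)) (cong (+ n ℤ.*_) (trans (ℤₚ.*-identityʳ (+ d)) (cong +_ (sym (*-identityʳ d)))))))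
  (ℚᵘₚ.≃-sym (toℚᵘ-/1 n)))))

≤-*-inv : ∀ {c x y} → 0ℚ ℚ.< x → c ℚ.* x ℚ.≤ y → c ℚ.≤ y ℚ.* inv x
≤-*-inv {c} {x} {y} x>0 cx≤y = subst (ℚ._≤ y ℚ.* inv x)
  (trans (ℚₚ.*-assoc c x (inv x)) (trans (cong (c ℚ.*_) (*-inv x>0)) (ℚₚ.*-identityʳ c)))
  (*-monoʳ (inv≥0 x>0) cx≤y)

mid≤ : ∀ {a b} → a ℚ.≤ b → mid a b ℚ.≤ b
mid≤ {a} {b} a≤b = subst (mid a b ℚ.≤_) (solve 1 (λ b → con ½ :* (b :+ b) := b) refl b)
  (*-monoˡ 0≤½ (ℚₚ.+-monoˡ-≤ b a≤b))

mid>0 : ∀ {a b} → 0ℚ ℚ.< a → 0ℚ ℚ.< b → 0ℚ ℚ.< mid a b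
mid>0 a>0 b>0 = *-pos 0<½ (ℚₚ.+-mono-< a>0 b>0)

-- A Riemann sum of dt/t depends only on the ratio b/a and grows with it. Bisection preserves the
-- comparison, as (a+b)/(2a) and 2b/(a+b) both increase with b/a.
riemann-mono-ratio : ∀ k {a b a′ b′} → 0ℚ ℚ.< a → 0ℚ ℚ.< b → 0ℚ ℚ.< a′ → 0ℚ ℚ.< b′ →
  b ℚ.* a′ ℚ.≤ b′ ℚ.* a → riemann k a b ℚ.≤ riemann k a′ b′
riemann-mono-ratio zero {a} {b} {a′} {b′} a>0 b>0 a′>0 b′>0 ba′≤b′a =
  subst₂ ℚ._≤_ (sym (expand b a>0)) (sym (expand b′ a′>0)) (ℚₚ.+-monoˡ-≤ (ℚ.- 1ℚ) b/a≤b′/a′)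
  where
  expand : ∀ {a} b → 0ℚ ℚ.< a → (b ℚ.- a) ℚ.* inv a ≡ b ℚ.* inv a ℚ.- 1ℚ
  expand {a} b a>0 = trans (solve 3 (λ a b i → (b :- a) :* i := b :* i :- a :* i) refl a b (inv a))
    (cong (λ u → b ℚ.* inv a ℚ.- u) (*-inv a>0))
  b/a≤b′/a′ : b ℚ.* inv a ℚ.≤ b′ ℚ.* inv a′
  b/a≤b′/a′ = ≤-*-inv a′>0 (subst₂ ℚ._≤_
    (solve 3 (λ b c i → b :* c :* i := b :* i :* c) refl b a′ (inv a))
    (trans (ℚₚ.*-assoc b′ a (inv a)) (trans (cong (b′ ℚ.*_) (*-inv a>0)) (ℚₚ.*-identityʳ b′)))
    (*-monoʳ (inv≥0 a>0) ba′≤b′a))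
riemann-mono-ratio (suc k) {a} {b} {a′} {b′} a>0 b>0 a′>0 b′>0 ba′≤b′a = ℚₚ.+-mono-≤
  (riemann-mono-ratio k a>0 (mid>0 a>0 b>0) a′>0 (mid>0 a′>0 b′>0) (subst₂ ℚ._≤_
    (solve 3 (λ a b a′ → con ½ :* (a :* a′ :+ b :* a′) := con ½ :* (a :+ b) :* a′) refl a b a′)
    (solve 3 (λ a a′ b′ → con ½ :* (a :* a′ :+ b′ :* a) := con ½ :* (a′ :+ b′) :* a) refl a a′ b′)
    (*-monoˡ 0≤½ (ℚₚ.+-monoʳ-≤ (a ℚ.* a′) ba′≤b′a))))
  (riemann-mono-ratio k (mid>0 a>0 b>0) b>0 (mid>0 a′>0 b′>0) b′>0 (subst₂ ℚ._≤_
    (solve 3 (λ b a′ b′ → con ½ :* (b :* b′ :+ b :* a′) := b :* (con ½ :* (a′ :+ b′))) refl b a′ b′)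
    (solve 3 (λ a b b′ → con ½ :* (b :* b′ :+ b′ :* a) := b′ :* (con ½ :* (a :+ b))) refl a b b′)
    (*-monoˡ 0≤½ (ℚₚ.+-monoʳ-≤ (b ℚ.* b′) ba′≤b′a))))

-- The right-endpoint sum: evaluated at one fixed level, it bounds the Riemann sums of all finer
-- levels from below.
lowerSum : ℕ → ℚ → ℚ → ℚ
lowerSum zero    a b = (b ℚ.- a) ℚ.* inv b
lowerSum (suc j) a b = lowerSum j a (mid a b) ℚ.+ lowerSum j (mid a b) b

lowerSum≤riemann : ∀ j k {a b} → 0ℚ ℚ.< a → a ℚ.≤ b → lowerSum j a b ℚ.≤ riemann (j + k) a b
lowerSum≤riemann zero    k a>0 a≤b = riemann-lower k a>0 a≤b
lowerSum≤riemann (suc j) k a>0 a≤b = ℚₚ.+-mono-≤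
  (lowerSum≤riemann j k a>0 (mid≥ ℚₚ.≤-refl a≤b))
  (lowerSum≤riemann j k (ℚₚ.<-≤-trans a>0 (mid≥ ℚₚ.≤-refl a≤b)) (mid≤ a≤b))

-- Bisecting [1, x] with x ≥ 2 leaves an upper half that contributes at least
-- 1/4, and a lower half whose right endpoint is at least x / 2.
riemann-2^ : ∀ m k {x} → (2 ^ m) /1 ℚ.≤ x → (+ 1 / 4) ℚ.* m /1 ℚ.≤ riemann (m + k) 1ℚ x
riemann-2^ zero    k {x} 1≤x = ℚₚ.≤-trans (*-nn x-1≥0 (inv≥0 (ℚₚ.<-≤-trans 0<1 1≤x))) (riemann-lower k 0<1 1≤x)
  where
  x-1≥0 : 0ℚ ℚ.≤ x ℚ.- 1ℚ
  x-1≥0 = ℚₚ.+-monoˡ-≤ (ℚ.- 1ℚ) 1≤x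
riemann-2^ (suc m) k {x} 2^m+1≤x = subst (ℚ._≤ riemann (suc m + k) 1ℚ x) (sym quarters)
  (ℚₚ.+-mono-≤ (riemann-2^ m k 2^m≤mid)
    (ℚₚ.≤-trans (≤-*-inv x>0 quarter) (riemann-lower (m + k) (mid>0 0<1 x>0) (mid≤ 1≤x))))
  where
  2≤x : 2 /1 ℚ.≤ x
  2≤x = ℚₚ.≤-trans (/1-mono (^-monoʳ-≤ 2 {1} {suc m} (s≤s z≤n))) 2^m+1≤x
  1≤x : 1ℚ ℚ.≤ x
  1≤x = ℚₚ.≤-trans (/1-mono {1} {2} (s≤s z≤n)) 2≤x
  x>0 : 0ℚ ℚ.< x
  x>0 = ℚₚ.<-≤-trans 0<1 1≤x
  quarters : (+ 1 / 4) ℚ.* suc m /1 ≡ (+ 1 / 4) ℚ.* m /1 ℚ.+ (+ 1 / 4)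
  quarters = trans (cong ((+ 1 / 4) ℚ.*_) (/1-suc m))
    (solve 1 (λ m → con (+ 1 / 4) :* (m :+ con 1ℚ) := con (+ 1 / 4) :* m :+ con (+ 1 / 4)) refl (m /1))
  2^m≤mid : (2 ^ m) /1 ℚ.≤ mid 1ℚ x
  2^m≤mid = ℚₚ.≤-trans (ℚₚ.≤-reflexive (trans
      (solve 1 (λ p → p := con ½ :* (con (2 /1) :* p)) refl ((2 ^ m) /1))
      (cong (½ ℚ.*_) (sym (/1-* 2 (2 ^ m))))))
    (*-monoˡ 0≤½ (ℚₚ.≤-trans 2^m+1≤x (subst (ℚ._≤ 1ℚ ℚ.+ x) (ℚₚ.+-identityˡ x) (ℚₚ.+-monoˡ-≤ x (ℚₚ.<⇒≤ 0<1)))))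
  quarter : (+ 1 / 4) ℚ.* x ℚ.≤ x ℚ.- mid 1ℚ x
  quarter = subst₂ ℚ._≤_
    (solve 1 (λ x → con (+ 1 / 4) :* (x :- con (2 /1)) :+ con ½ := con (+ 1 / 4) :* x) refl x)
    (solve 1 (λ x → con ½ :* (x :- con (2 /1)) :+ con ½ := x :- con ½ :* (con 1ℚ :+ x)) refl x)
    (ℚₚ.+-monoˡ-≤ ½ (*-monoʳ (ℚₚ.≤-trans (ℚₚ.≤-reflexive (sym (ℚₚ.+-inverseʳ (2 /1)))) (ℚₚ.+-monoˡ-≤ (ℚ.- (2 /1)) 2≤x))
      (from-yes ((+ 1 / 4) ℚₚ.≤? ½))))

-- A margin above 1 is needed to keep log log n away from 0. Three bisections give 1/5 + ⋯ + 1/12,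
-- about 1.02; two would give only 1/3 + 1/4 + 1/5 + 1/6 = 0.95.
riemann-3 : ∀ k → + 101 / 100 ℚ.≤ riemann (3 + k) 1ℚ (3 /1)
riemann-3 k = ℚₚ.≤-trans (from-yes (+ 101 / 100 ℚₚ.≤? lowerSum 3 1ℚ (3 /1)))
  (lowerSum≤riemann 3 k 0<1 (/1-mono {1} {3} (s≤s z≤n)))

at-least : ∀ (P : ℕ → Set) m → (∀ k → P (m + k)) → ∀ {k} → m ≤ k → P k
at-least P m h {k} m≤k = subst P (m+[n∸m]≡n m≤k) (h (k ∸ m))

-- `y` and `z` are the k-th terms of the sequences for log n and log log n; m and μ serve as binary
-- logarithms of n and m + 1.
module _ {n m μ k : ℕ} (3≤n : 3 ≤ n) (1≤m : 1 ≤ m) (2^m≤n : 2 ^ m ≤ n) (2^μ≤1+m : 2 ^ μ ≤ suc m)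
         (3≤k : 3 ≤ k) (m≤k : m ≤ k) (μ≤k : μ ≤ k) where

  private
    y z : ℚ
    y = riemann k 1ℚ (n /1)
    z = riemann k 1ℚ y

    y≥101/100 : + 101 / 100 ℚ.≤ y
    y≥101/100 = at-least (λ k → + 101 / 100 ℚ.≤ riemann k 1ℚ (n /1)) 3 (λ k → ℚₚ.≤-trans (riemann-3 k)
      (riemann-mono-ratio (3 + k) 0<1 (from-yes (0ℚ ℚₚ.<? 3 /1)) 0<1
        (ℚₚ.<-≤-trans (from-yes (0ℚ ℚₚ.<? 3 /1)) (/1-mono 3≤n)) (*-monoʳ (ℚₚ.<⇒≤ 0<1) (/1-mono 3≤n)))) 3≤k

    1≤y : 1ℚ ℚ.≤ y
    1≤y = ℚₚ.≤-trans (from-yes (1ℚ ℚₚ.≤? + 101 / 100)) y≥101/100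

  -- The 8 comes from m + 1 ≤ 2 m and m/4 ≤ y.
  log-lower : suc m /1 ℚ.≤ 8 /1 ℚ.* y
  log-lower = ℚₚ.≤-trans (/1-mono (+-monoˡ-≤ m 1≤m)) (ℚₚ.≤-trans
    (ℚₚ.≤-reflexive (trans (/1-+ m m)
      (solve 1 (λ m → m :+ m := con (8 /1) :* (con (+ 1 / 4) :* m)) refl (m /1))))
    (*-monoˡ (0≤/1 8) (at-least (λ k → (+ 1 / 4) ℚ.* m /1 ℚ.≤ riemann k 1ℚ (n /1)) m
      (λ k → riemann-2^ m k (/1-mono 2^m≤n)) m≤k)))

  private
    z≥1/101 : + 1 / 101 ℚ.≤ z
    -- (y - 1)/y increases with y and equals 1/101 at y = 101/100.
    z≥1/101 = ℚₚ.≤-trans (≤-*-inv (ℚₚ.<-≤-trans 0<1 1≤y) (subst₂ ℚ._≤_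
        (solve 1 (λ y → con (+ 100 / 101) :* con (+ 101 / 100) :+ (con (+ 1 / 101) :* y :- con 1ℚ) := con (+ 1 / 101) :* y) refl y)
        (solve 1 (λ y → con (+ 100 / 101) :* y :+ (con (+ 1 / 101) :* y :- con 1ℚ) := y :- con 1ℚ) refl y)
        (ℚₚ.+-monoˡ-≤ ((+ 1 / 101) ℚ.* y ℚ.- 1ℚ) (*-monoˡ (from-yes (0ℚ ℚₚ.≤? + 100 / 101)) y≥101/100))))
      (riemann-lower k 0<1 1≤y)

    2^[μ-3]≤y : ∀ μ → 2 ^ μ ≤ suc m → (2 ^ (μ ∸ 3)) /1 ℚ.≤ y
    2^[μ-3]≤y 0 _ = 1≤y
    2^[μ-3]≤y 1 _ = 1≤y
    2^[μ-3]≤y 2 _ = 1≤y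
    2^[μ-3]≤y (suc (suc (suc j))) 8*2^j≤1+m = subst₂ ℚ._≤_
      (trans (cong ((+ 1 / 8) ℚ.*_) (/1-* 8 (2 ^ j))) (solve 1 (λ p → con (+ 1 / 8) :* (con (8 /1) :* p) := p) refl ((2 ^ j) /1)))
      (solve 1 (λ y → con (+ 1 / 8) :* (con (8 /1) :* y) := y) refl y)
      (*-monoˡ (from-yes (0ℚ ℚₚ.≤? + 1 / 8)) (ℚₚ.≤-trans
        (/1-mono (≤-trans (≤-reflexive (8*2^j≡2^[3+j])) 8*2^j≤1+m)) log-lower))
      where
      8*2^j≡2^[3+j] : 8 * 2 ^ j ≡ 2 ^ (3 + j)
      8*2^j≡2^[3+j] = sym (^-distribˡ-+-* 2 3 j)

  -- μ + 1 ≤ 4 + (μ ∸ 3): the constant 4 = 404/101 is absorbed by z ≥ 1/101, and the rest by (μ ∸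
  -- 3)/4 ≤ z.
  loglog-lower : suc μ /1 ℚ.≤ 408 /1 ℚ.* z
  loglog-lower = ℚₚ.≤-trans (/1-mono (s≤s (m≤n+m∸n μ 3))) (ℚₚ.≤-trans
    (ℚₚ.≤-reflexive (trans (/1-+ 4 (μ ∸ 3))
      (solve 1 (λ j → con (4 /1) :+ j := con (404 /1) :* con (+ 1 / 101) :+ con (4 /1) :* (con (+ 1 / 4) :* j)) refl ((μ ∸ 3) /1))))
    (ℚₚ.≤-trans
      (ℚₚ.+-mono-≤ (*-monoˡ (0≤/1 404) z≥1/101)
        (*-monoˡ (0≤/1 4) (at-least (λ k → (+ 1 / 4) ℚ.* (μ ∸ 3) /1 ℚ.≤ riemann k 1ℚ y) (μ ∸ 3)
          (λ k → riemann-2^ (μ ∸ 3) k (2^[μ-3]≤y μ 2^μ≤1+m)) (≤-trans (m∸n≤m μ 3) μ≤k))))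
      (ℚₚ.≤-reflexive (solve 1 (λ z → con (404 /1) :* z :+ con (4 /1) :* z := con (408 /1) :* z) refl z))))

-- Assembly of the constants and passage to the reals

C : ℕ
C = 48 * 8 * 408

rational-bound : ∀ {S n f L l : ℕ} .{{_ : NonZero f}} {y z} → S * f ≤ 48 * (n * L * l) → 0ℚ ℚ.≤ z →
  L /1 ℚ.≤ 8 /1 ℚ.* y → l /1 ℚ.≤ 408 /1 ℚ.* z → S /1 ℚ.≤ C /1 ℚ.* (+ n / f) ℚ.* y ℚ.* z
rational-bound {S} {n} {f} {L} {l} {y} {z} Sf≤ z≥0 L≤ l≤ = ℚₚ.≤-trans
  (ℚₚ.*-cancelʳ-≤-pos (f /1) {{ℚ.positive f>0}} (ℚₚ.≤-trans (ℚₚ.≤-reflexive (sym (/1-* S f)))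
    (ℚₚ.≤-trans (/1-mono Sf≤) (ℚₚ.≤-reflexive expand))))
  (ℚₚ.≤-trans (*-monoˡ (*-nn (0≤/1 48) q≥0) (*-mono (0≤/1 L) (*-nn (0≤/1 408) z≥0) L≤ l≤))
    (ℚₚ.≤-reflexive (solve 3 (λ q y z → con (48 /1) :* q :* (con (8 /1) :* y :* (con (408 /1) :* z)) := con (C /1) :* q :* y :* z) refl q y z)))
  where
  q : ℚ
  q = + n / f
  f>0 : 0ℚ ℚ.< f /1
  f>0 = ℚₚ.<-≤-trans 0<1 (/1-mono (ℕ.>-nonZero⁻¹ f))
  q≥0 : 0ℚ ℚ.≤ q
  q≥0 = ℚₚ.*-cancelʳ-≤-pos (f /1) {{ℚ.positive f>0}}
    (subst₂ ℚ._≤_ (sym (ℚₚ.*-zeroˡ (f /1))) (sym (/-*-cancel n f)) (0≤/1 n))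
  expand : (48 * (n * L * l)) /1 ≡ 48 /1 ℚ.* q ℚ.* (L /1 ℚ.* l /1) ℚ.* f /1
  expand = trans (/1-* 48 (n * L * l)) (trans (cong (48 /1 ℚ.*_) (trans (/1-* (n * L) l)
    (trans (cong (ℚ._* l /1) (/1-* n L)) (cong (λ u → u ℚ.* L /1 ℚ.* l /1) (sym (/-*-cancel n f))))))
    (solve 4 (λ q f L l → con (48 /1) :* (q :* f :* L :* l) := con (48 /1) :* q :* (L :* l) :* f) refl q (f /1) (L /1) (l /1)))

≤-+ε : ∀ {p q ε} → 0ℚ ℚ.< ε → p ℚ.≤ q → p ℚ.≤ q ℚ.+ ε
≤-+ε {p} {q} {ε} ε>0 p≤q = subst (ℚ._≤ q ℚ.+ ε) (ℚₚ.+-identityʳ p) (ℚₚ.+-mono-≤ p≤q (ℚₚ.<⇒≤ ε>0))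

-- At n = 2 the factor log log n is negative although s(2, 1) = 2, so the range starts at 3.
theorem1p2 : Σ[ c ∈ ℝ ] ((n : ℕ) (n≥3 : 3 ≤ n) →
    let n≥2      = <⇒≤ n≥3
        n≥1      = <⇒≤ n≥2
        n>0      = 0<fromℕ n≥1
        n/φ[n]   = (+ n / φ n) {{φ-nonZero n≥1}}
        log-n    = log (fromℕ n) n>0
        loglog-n = log log-n (0<log n≥2 n>0)
    in ∃[ d ] (1 ≤ d × d ≤ n ∸ 1 × gcd n d ≡ 1 ×
               fromℕ (s n d) ≤ᵣ c *ᵣ fromℚ n/φ[n] *ᵣ log-n *ᵣ loglog-n))
theorem1p2 = fromℕ C , λ n n≥3 →
  let n≥1                          = <⇒≤ (<⇒≤ n≥3)
      m , 2^m≤n , n<2^1+m          = dyadic n n≥1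
      1≤m                          = 2^-cancel-≤ {1} {m} (<-≤-trans n≥3 (<⇒≤ n<2^1+m))
      μ , 2^μ≤1+m , 1+m<2^1+μ      = dyadic (suc m) (s≤s z≤n)
      d , 1≤d , d≤n-1 , n⊥d , sφ≤  = small-quotient-sum n n≥3 2^m≤n n<2^1+m (s≤s z≤n) 1+m<2^1+μ
  -- The inequality holds without slack from index 3 + m + μ on, where the Riemann level is at least
  -- 3, m and μ at once.
  in d , 1≤d , d≤n-1 , n⊥d , λ ε ε>0 → 3 + m + μ , λ k N≤k →
    let m+3≤k    = m+n≤o⇒m≤o (3 + m) N≤k
        3≤k      = m+n≤o⇒m≤o 3 m+3≤k
        m≤k      = m+n≤o⇒n≤o 3 m+3≤k
        μ≤k      = m+n≤o⇒n≤o (3 + m) N≤k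
        loglog≥  = loglog-lower n≥3 1≤m 2^m≤n 2^μ≤1+m 3≤k m≤k μ≤k
        y        = riemann k 1ℚ (n /1)
        z        = riemann k 1ℚ y
        z≥0      = ℚₚ.*-cancelˡ-≤-pos (408 /1) (ℚₚ.≤-trans (0≤/1 (suc μ)) loglog≥)
    in ≤-+ε ε>0 (rational-bound {s n d} {n} {φ n} {suc m} {suc μ} {{φ-nonZero n≥1}} {y} {z} sφ≤ z≥0
         (log-lower n≥3 1≤m 2^m≤n 2^μ≤1+m 3≤k m≤k μ≤k) loglog≥)
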